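{- The class of $(\overline{2P_1+P_2},\,P_2+P_3)$-free graphs is well-quasi-ordered by the labelled induced subgraph relation.
   Context: Graphs are finite, undirected and simple. $P_r$ is the path on $r$ vertices, $G+H$ is the disjoint union of vertex-disjoint graphs $G,H$, $rG$ is the disjoint union of $r$ copies of $G$, and $\overline{G}$ is the complement of $G$. A graph is $(H_1,\ldots,H_p)$-free if it has no induced subgraph isomorphic to any of $H_1,\ldots,H_p$. A quasi-order is a reflexive, transitive relation. A quasi-order $\leq$ on a set $W$ is a well-quasi-order if every infinite sequence $x_1,x_2,\ldots$ in $W$ contains a pair with $x_i\leq x_j$, $i<j$ (equivalently: no infinite strictly decreasing sequence and no infinite antichain, an antichain being a set of pairwise incomparable elements). Given a quasi-order $(W,\leq)$, a labelled graph is a graph $G$ in which each vertex $v$ is assigned a label $l_G(v)\in W$. For labelled graphs $G,H$, $G$ is a labelled induced subgraph of $H$ if there is an isomorphism from $G$ to an induced subgraph of $H$ mapping each vertex $v$ of $G$ to a vertex $w$ of $H$ with $l_G(v)\leq l_H(w)$. A class $X$ of graphs is well-quasi-ordered by the labelled induced subgraph relation if, for every well-quasi-order $(W,\leq)$, there is no infinite antichain (with respect to the labelled induced subgraph relation) of graphs from $X$ labelled with elements of $W$. -}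

module Defs where

open import Level using (Level; 0ℓ; _⊔_) renaming (suc to lsuc)
open import Data.Bool using (Bool; true; false; not; _∧_; _∨_)
open import Data.Bool.Properties using (∨-comm)
open import Data.Fin using (Fin; toℕ; splitAt)
open import Data.Fin.Properties using (_≟_)
open import Data.List using (List)
open import Data.List.Relation.Unary.All using (All)
open import Data.Nat as ℕ using (ℕ; zero; suc; _+_; _<_)
open import Data.Nat.Properties using (1+n≢n)
open import Data.Product using (_×_; ∃₂; ∃-syntax)
open import Data.Sum using (_⊎_; inj₁; inj₂)
open import Function.Definitions using (Injective)
open import Relation.Binary using (Rel; IsPreorder)
open import Relation.Binary.PropositionalEquality
  using (_≡_; _≢_; refl; sym; cong; cong₂)
open import Relation.Nullary using (¬_; yes; no)
open import Relation.Nullary.Decidable using (does; dec-true; dec-false)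
open import Relation.Unary using (Pred)

-- Adjacency is Boolean so that Graph lives in Set.
record Graph : Set where
  field
    order      : ℕ
    adj        : Fin order → Fin order → Bool
    adj-sym    : ∀ u v → adj u v ≡ adj v u
    adj-irrefl : ∀ v → adj v v ≡ false

  Vertex : Set
  Vertex = Fin order

open Graph using (Vertex)

P : ℕ → Graph
P r = record
  { order      = r
  ; adj        = λ u v → next u v ∨ next v u
  ; adj-sym    = λ u v → ∨-comm (next u v) (next v u)
  ; adj-irrefl = λ v → cong₂ _∨_ (next-irrefl v) (next-irrefl v)
  }
  where
  next : Fin r → Fin r → Bool
  next u v = does (suc (toℕ u) ℕ.≟ toℕ v)

  next-irrefl : ∀ v → next v v ≡ false
  next-irrefl v = dec-false (suc (toℕ v) ℕ.≟ toℕ v) 1+n≢n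

infixl 6 _⊕_
infixr 7 _·_

-- Disjoint union: splitAt identifies Fin (m + n) with Fin m ⊎ Fin n.
_⊕_ : Graph → Graph → Graph
G ⊕ H = record
  { order      = G.order + H.order
  ; adj        = λ u v → adj⊎ (splitAt G.order u) (splitAt G.order v)
  ; adj-sym    = λ u v → adj⊎-sym (splitAt G.order u) (splitAt G.order v)
  ; adj-irrefl = λ v → adj⊎-irrefl (splitAt G.order v)
  }
  where
  module G = Graph G
  module H = Graph H

  adj⊎ : Vertex G ⊎ Vertex H → Vertex G ⊎ Vertex H → Bool
  adj⊎ (inj₁ u) (inj₁ v) = G.adj u v
  adj⊎ (inj₁ _) (inj₂ _) = false
  adj⊎ (inj₂ _) (inj₁ _) = false
  adj⊎ (inj₂ u) (inj₂ v) = H.adj u v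

  adj⊎-sym : ∀ x y → adj⊎ x y ≡ adj⊎ y x
  adj⊎-sym (inj₁ u) (inj₁ v) = G.adj-sym u v
  adj⊎-sym (inj₁ _) (inj₂ _) = refl
  adj⊎-sym (inj₂ _) (inj₁ _) = refl
  adj⊎-sym (inj₂ u) (inj₂ v) = H.adj-sym u v

  adj⊎-irrefl : ∀ x → adj⊎ x x ≡ false
  adj⊎-irrefl (inj₁ v) = G.adj-irrefl v
  adj⊎-irrefl (inj₂ v) = H.adj-irrefl v

_·_ : ℕ → Graph → Graph
zero  · G = P 0
suc r · G = G ⊕ r · G

complement : Graph → Graph
complement G = record
  { order      = G.order
  ; adj        = λ u v → not (does (u ≟ v)) ∧ not (G.adj u v)
  ; adj-sym    = λ u v →
      cong₂ _∧_ (cong not (≟-sym u v)) (cong not (G.adj-sym u v))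
  ; adj-irrefl = λ v →
      cong (λ b → not b ∧ not (G.adj v v)) (dec-true (v ≟ v) refl)
  }
  where
  module G = Graph G

  ≟-sym : (u v : Vertex G) → does (u ≟ v) ≡ does (v ≟ u)
  ≟-sym u v with u ≟ v
  ... | yes u≡v = sym (dec-true (v ≟ u) (sym u≡v))
  ... | no  u≢v = sym (dec-false (v ≟ u) (λ v≡u → u≢v (sym v≡u)))

-- Such a map is exactly an isomorphism from G onto the subgraph of H
-- induced by its image.
record IsInducedEmbedding (G H : Graph) (f : Vertex G → Vertex H) : Set where
  field
    injective : Injective _≡_ _≡_ f
    adj-≡     : ∀ u v → Graph.adj G u v ≡ Graph.adj H (f u) (f v)

_IsInducedSubgraphOf_ : Rel Graph 0ℓ
G IsInducedSubgraphOf H =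
  ∃[ f ] IsInducedEmbedding G H f

Free : List Graph → Pred Graph 0ℓ
Free Hs G = All (λ H → ¬ (H IsInducedSubgraphOf G)) Hs

private variable
  a ℓ c : Level

record IsWellQuasiOrder {W : Set a} (_≤_ : Rel W ℓ) : Set (a ⊔ ℓ) where
  field
    isPreorder : IsPreorder _≡_ _≤_
    good       : (x : ℕ → W) → ∃₂ λ i j → i < j × x i ≤ x j

record LabelledGraph (W : Set a) : Set a where
  field
    graph : Graph
    label : Vertex graph → W

open LabelledGraph public using (graph; label)

LabelledInducedSubgraph :
  {W : Set a} → Rel W ℓ → Rel (LabelledGraph W) ℓ
LabelledInducedSubgraph _≤_ G H =
  ∃[ f ] IsInducedEmbedding (graph G) (graph H) f
       × (∀ v → label G v ≤ label H (f v))

-- The members of an infinite antichain are listed as a sequence; when _≲_ is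
-- reflexive, incomparability makes the listed elements distinct.
IsInfiniteAntichain : {A : Set a} → Rel A ℓ → (ℕ → A) → Set ℓ
IsInfiniteAntichain _≲_ x = ∀ i j → i ≢ j → ¬ (x i ≲ x j)

-- The levels a and ℓ are those of the label sets and of their quasi-orders.
WQOByLabelledInducedSubgraph : ∀ a ℓ → Pred Graph c → Set (lsuc (a ⊔ ℓ) ⊔ c)
WQOByLabelledInducedSubgraph a ℓ X =
  (W : Set a) (_≤_ : Rel W ℓ) → IsWellQuasiOrder _≤_ →
  ¬ (∃[ G ] (∀ (i : ℕ) → X (graph (G i)))
          × IsInfiniteAntichain (LabelledInducedSubgraph _≤_) G)

-- Give each vertex a type from a finite set and an address consisting of a level and a block. If
-- adjacency depends only on the types and on the relative position of the addresses, then graphs are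
-- lists (of levels) of lists (of blocks) of lists of labelled vertices, and three applications of
-- Higman's lemma yield the well-quasi-order; boundedly many additional vertices do no harm. So it
-- suffices to represent all graphs G of the class by finitely many such schemes.
--
-- If G contains K₅, then a maximal clique leaves a disjoint union of cliques. If G contains K₄ but no
-- K₅, or no K₄ but two disjoint triangles joined by no edge, one edge or three edges, or no two
-- disjoint triangles but C₅, fix such an anchor F. The adjacency between vertices with prescribed
-- neighbours in F follows a default, and after deleting boundedly many vertices the pairs deviating
-- from it form a disjoint union of cliques; this follows from exhaustive searches in small
-- configurations. Two triangles joined by two edges leave, up to matchings, a bipartite graph. In all
-- other cases G is bipartite after deletion of a triangle.
--
-- In a (P₂+P₃)-free bipartite graph, two vertices on one side have nested neighbourhoods or
-- neighbourhoods that differ by the exchange of one vertex. Hence the levels, given by the degrees,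
-- are nested, and a single level induces a matching or the complement of one.
module Submission where

open import Level using (Level; 0ℓ; _⊔_; Lift; lift; lower)
open import Axiom.ExcludedMiddle using (ExcludedMiddle)
open import Data.Bool using (Bool; true; false; not; _∧_; _∨_; if_then_else_; T)
open import Data.Bool.Properties using (¬-not; not-involutive; ∧-comm; ∨-zeroʳ) renaming (_≟_ to _≟ᵇ_)
open import Data.Empty using (⊥; ⊥-elim)
open import Data.Fin as Fin using (Fin; zero; suc; toℕ; fromℕ<; combine; join)
open import Data.Fin.Patterns
open import Data.Fin.Properties using (toℕ-fromℕ<; toℕ-injective; pigeonhole; combine-injective; splitAt-join; all?)
open import Data.List as List using (List; []; _∷_; _++_; length; cartesianProduct)
open import Data.List.Properties using (length-++)
open import Data.List.Membership.Propositional using (_∈_)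
open import Data.List.Membership.Propositional.Properties
  using (∈-++⁺ˡ; ∈-++⁺ʳ; ∈-map⁺; ∈-filter⁺; ∈-filter⁻; ∈-allFin; ∈-lookup; ∈-cartesianProduct⁺)
open import Data.List.Relation.Binary.Sublist.Heterogeneous using (Sublist; []; _∷_; _∷ʳ_; minimum)
import Data.List.Relation.Binary.Sublist.Heterogeneous.Properties as Sublistₚ
open import Data.List.Relation.Unary.All as All using (All; []; _∷_)
open import Data.List.Relation.Unary.AllPairs using ([]; _∷_)
open import Data.List.Relation.Unary.Any as Any using (here; there; index)
open import Data.List.Relation.Unary.Any.Properties using (lookup-index)
open import Data.List.Relation.Unary.Unique.Propositional using (Unique)
open import Data.List.Relation.Unary.Unique.Propositional.Properties using (filter⁺; allFin⁺)
open import Data.Nat as ℕ using (ℕ; zero; suc; pred; _+_; _∸_; _<_; _≤_; _≡ᵇ_; z≤n; s≤s)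
open import Data.Nat.Properties as ℕₚ
  using (≤-refl; ≤-trans; ≤-reflexive; ≤-pred; <⇒≤; <⇒≱; <⇒≢; ≮⇒≥; n≮0; <-cmp; <-irrefl; <-trans; <-≤-trans;
         m<1+n⇒m<n∨m≡n; m<n⇒m<1+n; n<1+n; n≤1+n; _<?_; n∸n≡0; ∸-monoˡ-<; m≤m⊔n; m≤n⊔m; +-suc)
open import Data.Product using (Σ; ∃; ∃₂; _×_; _,_; -,_; proj₁; proj₂)
open import Data.Sum as Sum using (_⊎_; inj₁; inj₂)
open import Data.Sum.Properties using (inj₁-injective; inj₂-injective)
open import Data.Unit using (⊤; tt)
open import Data.Vec as Vec using (Vec; []; _∷_; map; lookup; replicate; toList)
open import Data.Vec.Properties using (≡-dec; length-toList)
open import Data.Vec.Relation.Unary.All as Allᵛ using ([]; _∷_)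
open import Data.Vec.Relation.Unary.All.Properties using (lookup⁺)
open import Function using (_∘_)
open import Relation.Binary using (Transitive; IsPreorder; tri<; tri≈; tri>)
open import Relation.Binary.PropositionalEquality
open import Relation.Nullary using (¬_; Dec; yes; no; does; isYes)
open import Relation.Nullary.Decidable using (map′; _×-dec_; _→-dec_; from-yes; toWitness; dec-true; dec-false)
open import Defs
open Graph using (Vertex)

-- Higman's lemma

-- The searches do not show that deviation from the default is transitive. They show that two paths
-- of deviating pairs with the same classes cannot coexist without deviating from each other. So one
-- path is chosen for every triple of classes and deleted together with everything that deviates
-- from it; then no path with these classes is left. The deletion is bounded because the vertices of
-- a class that deviate from a common vertex form a clique, and this is why large cliques are split
-- off beforehand.
--
-- Five is the threshold there because three vertices outside a maximal clique have at most one
-- neighbour each in it. They leave an edge of it untouched, which is forbidden beside an induced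
-- path on these three vertices.
--
-- In a bipartite graph the neighbourhoods of a given degree are sets of equal size, any two of
-- which differ by one exchange. Such a family either shares all but one element or lies in a set
-- with one element more, whence the matching or its complement.
--
-- No bound may depend on the graph, since a single finite set of types has to serve the whole
-- sequence.

module WQO {ℓ : Level} (em : ExcludedMiddle ℓ) where

  Good : {A : Set} → (A → A → Set ℓ) → Set ℓ
  Good {A} R = ∀ (x : ℕ → A) → ∃₂ λ i j → i < j × R (x i) (x j)

  steps⇒mono : {f : ℕ → ℕ} → (∀ n → f n < f (suc n)) → ∀ {i j} → i < j → f i < f j
  steps⇒mono {f} step {i} {suc j} i<1+j with m<1+n⇒m<n∨m≡n i<1+j
  ... | inj₁ i<j = <-trans (steps⇒mono step i<j) (step j)
  ... | inj₂ refl = step j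

  module _ {A : Set} {R : A → A → Set ℓ} (R-trans : Transitive R) (good : Good R) where

    -- If terminal indices were unbounded, they would form a bad sequence.
    ascending : ∀ (x : ℕ → A) → Σ (ℕ → ℕ) λ φ → ∀ {i j} → i < j → φ i < φ j × R (x (φ i)) (x (φ j))
    ascending x with em {∃ λ N → ∀ i → N ≤ i → ∃ λ j → i < j × R (x i) (x j)}
    ... | yes (N , next) = φ , λ i<j → steps⇒mono φ-step i<j , rel i<j
      where
      chain : ℕ → ∃ (N ≤_)
      chain zero = N , ≤-refl
      chain (suc n) with chain n
      ... | i , N≤i = proj₁ (next i N≤i) , ≤-trans N≤i (<⇒≤ (proj₁ (proj₂ (next i N≤i))))

      φ : ℕ → ℕ
      φ n = proj₁ (chain n)

      φ-step : ∀ n → φ n < φ (suc n)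
      φ-step n = proj₁ (proj₂ (next (φ n) (proj₂ (chain n))))

      rel : ∀ {i j} → i < j → R (x (φ i)) (x (φ j))
      rel {i} {suc j} i<1+j with m<1+n⇒m<n∨m≡n i<1+j | proj₂ (proj₂ (next (φ j) (proj₂ (chain j))))
      ... | inj₁ i<j | r = R-trans (rel i<j) r
      ... | inj₂ refl | r = r
    ... | no ¬tail = ⊥-elim (terminal-free (good (λ n → x (t n))))
      where
      terminal : ∀ N → ∃ λ i → N ≤ i × (∀ j → i < j → ¬ R (x i) (x j))
      terminal N with em {∃ λ i → N ≤ i × (∀ j → i < j → ¬ R (x i) (x j))}
      ... | yes p = p
      ... | no ¬p = ⊥-elim (¬tail (N , extend))
        where
        extend : ∀ i → N ≤ i → ∃ λ j → i < j × R (x i) (x j)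
        extend i N≤i with em {∃ λ j → i < j × R (x i) (x j)}
        ... | yes q = q
        ... | no ¬q = ⊥-elim (¬p (i , N≤i , λ j i<j r → ¬q (j , i<j , r)))

      t : ℕ → ℕ
      t zero = proj₁ (terminal 0)
      t (suc n) = proj₁ (terminal (suc (t n)))

      t-terminal : ∀ n j → t n < j → ¬ R (x (t n)) (x j)
      t-terminal zero = proj₂ (proj₂ (terminal 0))
      t-terminal (suc n) = proj₂ (proj₂ (terminal (suc (t n))))

      terminal-free : ¬ (∃₂ λ i j → i < j × R (x (t i)) (x (t j)))
      terminal-free (i , j , i<j , r) =
        t-terminal i (t j) (steps⇒mono (λ n → proj₁ (proj₂ (terminal (suc (t n))))) i<j) r

    private
      _⊑_ = Sublist R

      Bad : (ℕ → List A) → Set ℓ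
      Bad w = ∀ {i j} → i < j → ¬ (w i ⊑ w j)

      Agree : ℕ → (ℕ → List A) → (ℕ → List A) → Set
      Agree n w v = ∀ {i} → i < n → w i ≡ v i

      Minimal : ℕ → (ℕ → List A) → Set ℓ
      Minimal n v = ∀ u → Agree n v u → Bad u → length (v n) ≤ length (u n)

      -- The bound `L` on the length of the n-th word turns the choice of a shortest one into a
      -- structural induction.
      minimise : ∀ n L w → length (w n) ≤ L → Bad w → ∃ λ v → Agree n w v × Bad v × Minimal n v
      minimise n L w w≤L bad
        with em {∃ λ u → Agree n w u × Bad u × length (u n) < length (w n)}
      ... | no ¬shorter = w , (λ _ → refl) , bad
                        , λ u agree u-bad → ≮⇒≥ λ u<w → ¬shorter (u , agree , u-bad , u<w)
      minimise n zero w w≤L bad | yes (u , agree , u-bad , u<w) =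
        ⊥-elim (n≮0 (<-≤-trans u<w w≤L))
      minimise n (suc L) w w≤L bad | yes (u , agree , u-bad , u<w)
        with minimise n L u (≤-pred (<-≤-trans u<w w≤L)) u-bad
      ... | v , agree′ , rest = v , (λ i<n → trans (agree i<n) (agree′ i<n)) , rest

    -- Higman's lemma, by Nash-Williams' minimal bad sequence argument.
    higman : Good (Sublist R)
    higman w₀ with em {∃₂ λ i j → i < j × (w₀ i ⊑ w₀ j)}
    ... | yes g = g
    ... | no ¬g = ⊥-elim (no-minimal-bad (ascending hd))
      where
      W : ℕ → ∃ Bad
      step : ∀ n → ∃ λ v → Agree n (proj₁ (W n)) v × Bad v × Minimal n v
      W zero = w₀ , λ i<j s → ¬g (_ , _ , i<j , s)
      W (suc n) = proj₁ (step n) , proj₁ (proj₂ (proj₂ (step n)))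
      step n = minimise n _ (proj₁ (W n)) ≤-refl (proj₂ (W n))

      m : ℕ → List A
      m n = proj₁ (W (suc n)) n

      W-agree : ∀ n → Agree n (proj₁ (W n)) m
      W-agree (suc n) {i} i<1+n with m<1+n⇒m<n∨m≡n i<1+n
      ... | inj₂ refl = refl
      ... | inj₁ i<n = trans (sym (proj₁ (proj₂ (step n)) i<n)) (W-agree n i<n)

      m-bad : Bad m
      m-bad {i} {j} i<j s = proj₂ (W (suc j)) i<j
        (subst (_⊑ m j) (sym (W-agree (suc j) (m<n⇒m<1+n i<j))) s)

      m-minimal : ∀ n → Minimal n m
      m-minimal n u agree = proj₂ (proj₂ (proj₂ (step n))) u
        λ i<n → trans (W-agree (suc n) (m<n⇒m<1+n i<n)) (agree i<n)

      m-cons : ∀ n → ∃₂ λ a r → m n ≡ a ∷ r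
      m-cons n with m n in eq
      ... | a ∷ r = a , r , refl
      ... | [] = ⊥-elim (m-bad (n<1+n n) (subst (_⊑ m (suc n)) (sym eq) (minimum _)))

      hd : ℕ → A
      hd n = proj₁ (m-cons n)

      tl : ℕ → List A
      tl n = proj₁ (proj₂ (m-cons n))

      m≡ : ∀ n → m n ≡ hd n ∷ tl n
      m≡ n = proj₂ (proj₂ (m-cons n))

      tl⊑ : ∀ {xs} n → xs ⊑ tl n → xs ⊑ m n
      tl⊑ n s = subst (_ ⊑_) (sym (m≡ n)) (hd n ∷ʳ s)

      no-minimal-bad : ¬ (Σ (ℕ → ℕ) λ φ → ∀ {i j} → i < j → φ i < φ j × R (hd (φ i)) (hd (φ j)))
      no-minimal-bad (φ , asc) = <⇒≱ shorter (m-minimal (φ 0) v v-agree v-bad)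
        where
        -- The sequence that contradicts minimality: the chosen words before `φ 0`, then the tails
        -- along the subsequence whose heads ascend.
        v : ℕ → List A
        v i with i <? φ 0
        ... | yes _ = m i
        ... | no  _ = tl (φ (i ∸ φ 0))

        φ0≤ : ∀ k → φ 0 ≤ φ k
        φ0≤ zero = ≤-refl
        φ0≤ (suc k) = <⇒≤ (proj₁ (asc (s≤s z≤n)))

        v-agree : Agree (φ 0) m v
        v-agree {i} i<φ0 with i <? φ 0
        ... | yes _ = refl
        ... | no i≮φ0 = ⊥-elim (i≮φ0 i<φ0)

        v-bad : Bad v
        v-bad {i} {j} i<j s with i <? φ 0 | j <? φ 0
        ... | yes _ | yes _ = m-bad i<j s
        ... | yes i<φ0 | no _ = m-bad (<-≤-trans i<φ0 (φ0≤ (j ∸ φ 0))) (tl⊑ _ s)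
        ... | no i≮φ0 | yes j<φ0 = i≮φ0 (<-trans i<j j<φ0)
        ... | no i≮φ0 | no _ with asc (∸-monoˡ-< i<j (≮⇒≥ i≮φ0))
        ... | φ< , r = m-bad φ< (subst₂ _⊑_ (sym (m≡ _)) (sym (m≡ _)) (r ∷ s))

        v-φ0 : v (φ 0) ≡ tl (φ 0)
        v-φ0 with φ 0 <? φ 0
        ... | yes φ0<φ0 = ⊥-elim (<-irrefl refl φ0<φ0)
        ... | no _ = cong (λ k → tl (φ k)) (n∸n≡0 (φ 0))

        shorter : length (v (φ 0)) < length (m (φ 0))
        shorter = subst₂ (λ xs ys → length xs < length ys) (sym v-φ0) (sym (m≡ (φ 0))) ≤-refl

-- Represented graphs

Finite : Set → Set
Finite T = ∃ λ k → Σ (T → Fin k) λ code → ∀ {s t} → code s ≡ code t → s ≡ t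

-- Levels are compared by order, blocks only by equality and only within one level. This is what an
-- embedding of nested lists preserves and reflects, as it maps the blocks of each level
-- independently.
data Rel : Set where
  before after same apart : Rel

abstract
  rel : ℕ × ℕ → ℕ × ℕ → Rel
  rel (b , c) (b′ , c′) with <-cmp b b′ | c ℕ.≟ c′
  ... | tri< _ _ _ | _     = before
  ... | tri> _ _ _ | _     = after
  ... | tri≈ _ _ _ | yes _ = same
  ... | tri≈ _ _ _ | no _  = apart

  rel-before : ∀ {x y} → proj₁ x < proj₁ y → rel x y ≡ before
  rel-before {b , c} {b′ , c′} b<b′ with <-cmp b b′ | c ℕ.≟ c′
  ... | tri< _ _ _ | _ = refl
  ... | tri≈ b≮b′ _ _ | _ = ⊥-elim (b≮b′ b<b′)
  ... | tri> b≮b′ _ _ | _ = ⊥-elim (b≮b′ b<b′)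

  rel-after : ∀ {x y} → proj₁ y < proj₁ x → rel x y ≡ after
  rel-after {b , c} {b′ , c′} b′<b with <-cmp b b′ | c ℕ.≟ c′
  ... | tri> _ _ _ | _ = refl
  ... | tri≈ _ _ b′≮b | _ = ⊥-elim (b′≮b b′<b)
  ... | tri< _ _ b′≮b | _ = ⊥-elim (b′≮b b′<b)

  rel-same : ∀ {x y} → proj₁ x ≡ proj₁ y → proj₂ x ≡ proj₂ y → rel x y ≡ same
  rel-same {b , c} {b′ , c′} b≡b′ c≡c′ with <-cmp b b′ | c ℕ.≟ c′
  ... | tri≈ _ _ _ | yes _ = refl
  ... | tri≈ _ _ _ | no c≢c′ = ⊥-elim (c≢c′ c≡c′)
  ... | tri< _ b≢b′ _ | _ = ⊥-elim (b≢b′ b≡b′)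
  ... | tri> _ b≢b′ _ | _ = ⊥-elim (b≢b′ b≡b′)

  rel-apart : ∀ {x y} → proj₁ x ≡ proj₁ y → proj₂ x ≢ proj₂ y → rel x y ≡ apart
  rel-apart {b , c} {b′ , c′} b≡b′ c≢c′ with <-cmp b b′ | c ℕ.≟ c′
  ... | tri≈ _ _ _ | yes c≡c′ = ⊥-elim (c≢c′ c≡c′)
  ... | tri≈ _ _ _ | no _ = refl
  ... | tri< _ b≢b′ _ | _ = ⊥-elim (b≢b′ b≡b′)
  ... | tri> _ b≢b′ _ | _ = ⊥-elim (b≢b′ b≡b′)

converse : Rel → Rel
converse before = after
converse after  = before
converse same   = same
converse apart  = apart

rel-converse : ∀ x y → rel y x ≡ converse (rel x y)
rel-converse (b , c) (b′ , c′) with <-cmp b b′ | c ℕ.≟ c′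
... | tri< b<b′ _ _ | _ = trans (rel-after {b′ , c′} b<b′) (sym (cong converse (rel-before {b , c} b<b′)))
... | tri> _ _ b′<b | _ = trans (rel-before {b′ , c′} b′<b) (sym (cong converse (rel-after {b , c} b′<b)))
... | tri≈ _ b≡b′ _ | yes c≡c′ = trans (rel-same {b′ , c′} (sym b≡b′) (sym c≡c′)) (sym (cong converse (rel-same {b , c} b≡b′ c≡c′)))
... | tri≈ _ b≡b′ _ | no c≢c′ = trans (rel-apart {b′ , c′} (sym b≡b′) (c≢c′ ∘ sym)) (sym (cong converse (rel-apart {b , c} b≡b′ c≢c′)))

record Scheme : Set₁ where
  field
    Type   : Set
    finite : Finite Type
    φ      : Type → Type → Rel → Bool

-- D is the set of vertices about which nothing is said.
record Rep (S : Scheme) (G : Graph) (D : Vertex G → Set) : Set where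
  open Scheme S
  field
    type  : Vertex G → Type
    addr  : Vertex G → ℕ × ℕ
    adj-φ : ∀ u v → ¬ D u → ¬ D v → u ≢ v →
            Graph.adj G u v ≡ φ (type u) (type v) (rel (addr u) (addr v))

-- From addresses to nested lists and back

private
  bounded : ∀ {n} (f : Fin n → ℕ) → ∃ λ B → ∀ i → f i < B
  bounded {zero} f = 0 , λ ()
  bounded {suc n} f with bounded (f ∘ suc)
  ... | B , f<B = suc (f zero) ℕ.⊔ B , λ
    { zero → m≤m⊔n _ B ; (suc i) → <-≤-trans (f<B i) (m≤n⊔m (suc (f zero)) B) }

  StrictMono : ∀ {m n} → (Fin m → Fin n) → Set
  StrictMono σ = ∀ i j → toℕ i < toℕ j → toℕ (σ i) < toℕ (σ j)

  strictMono⇒injective : ∀ {m n} {σ : Fin m → Fin n} → StrictMono σ → ∀ {i j} → σ i ≡ σ j → i ≡ j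
  strictMono⇒injective mono {i} {j} σi≡σj with <-cmp (toℕ i) (toℕ j)
  ... | tri< i<j _ _ = ⊥-elim (<-irrefl (cong toℕ σi≡σj) (mono i j i<j))
  ... | tri≈ _ i≡j _ = toℕ-injective i≡j
  ... | tri> _ _ j<i = ⊥-elim (<-irrefl (cong toℕ (sym σi≡σj)) (mono j i j<i))

  abstract
    tabulate-sublist : ∀ {ℓ} {A : Set} {R : A → A → Set ℓ} {m n} {f : Fin m → A} {g : Fin n → A} →
      Sublist R (List.tabulate f) (List.tabulate g) →
      Σ (Fin m → Fin n) λ σ → StrictMono σ × (∀ i → R (f i) (g (σ i)))
    tabulate-sublist {m = zero} s = (λ ()) , (λ ()) , λ ()
    tabulate-sublist {m = suc m} {suc n} (_ ∷ʳ s) with tabulate-sublist {m = suc m} s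
    ... | σ , mono , r = suc ∘ σ , (λ i j i<j → s≤s (mono i j i<j)) , r
    tabulate-sublist {m = suc m} {suc n} {f} {g} (r₀ ∷ s) with tabulate-sublist s
    ... | σ , mono , r = σ⁺
        , (λ { zero (suc j) _ → s≤s z≤n ; (suc i) (suc j) (s≤s i<j) → s≤s (mono i j i<j) })
        , λ { zero → r₀ ; (suc i) → r i }
      where
      σ⁺ : Fin (suc m) → Fin (suc n)
      σ⁺ zero = zero
      σ⁺ (suc i) = suc (σ i)

  lookup-injective : ∀ {A : Set} {xs : List A} → Unique xs → ∀ i j → List.lookup xs i ≡ List.lookup xs j → i ≡ j
  lookup-injective (_ ∷ _) zero zero _ = refl
  lookup-injective {xs = _ ∷ xs} (x∉ ∷ _) zero (suc j) eq = ⊥-elim (All.lookup x∉ (∈-lookup j) eq)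
  lookup-injective {xs = _ ∷ xs} (x∉ ∷ _) (suc i) zero eq = ⊥-elim (All.lookup x∉ (∈-lookup i) (sym eq))
  lookup-injective (_ ∷ u) (suc i) (suc j) eq = cong suc (lookup-injective u i j eq)

module Grid {n} (addr : Fin n → ℕ × ℕ) where
  b c : Fin n → ℕ
  b = proj₁ ∘ addr
  c = proj₂ ∘ addr

  abstract
    B C : ℕ
    B = proj₁ (bounded b)
    C = proj₁ (bounded c)

    level : Fin n → Fin B
    level v = fromℕ< (proj₂ (bounded b) v)

    block : Fin n → Fin C
    block v = fromℕ< (proj₂ (bounded c) v)

    toℕ-level : ∀ v → toℕ (level v) ≡ b v
    toℕ-level v = toℕ-fromℕ< (proj₂ (bounded b) v)

    toℕ-block : ∀ v → toℕ (block v) ≡ c v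
    toℕ-block v = toℕ-fromℕ< (proj₂ (bounded c) v)

    at? : (β : Fin B) (γ : Fin C) (v : Fin n) → Dec (level v ≡ β × block v ≡ γ)
    at? β γ v = (level v Fin.≟ β) ×-dec (block v Fin.≟ γ)

    cell : Fin B → Fin C → List (Fin n)
    cell β γ = List.filter (at? β γ) (List.allFin n)

    cell-unique : ∀ β γ → Unique (cell β γ)
    cell-unique β γ = filter⁺ (at? β γ) (allFin⁺ n)

    at-lookup : ∀ β γ i → level (List.lookup (cell β γ) i) ≡ β × block (List.lookup (cell β γ) i) ≡ γ
    at-lookup β γ i = proj₂ (∈-filter⁻ (at? β γ) {xs = List.allFin n} (∈-lookup i))

    position : ∀ v {β γ} → level v ≡ β → block v ≡ γ → Fin (length (cell β γ))
    position v {β} {γ} p q = index (∈-filter⁺ (at? β γ) (∈-allFin v) (p , q))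

    lookup-position : ∀ v {β γ} (p : level v ≡ β) (q : block v ≡ γ) → v ≡ List.lookup (cell β γ) (position v p q)
    lookup-position v {β} {γ} p q = lookup-index (∈-filter⁺ (at? β γ) (∈-allFin v) (p , q))

  module _ {A : Set} (tag : Fin n → A) where
    cells : Fin B → Fin C → List A
    cells β γ = List.tabulate (tag ∘ List.lookup (cell β γ))

    rows : Fin B → List (List A)
    rows β = List.tabulate (cells β)

    -- Empty rows and cells are listed too, so that positions in the lists are the addresses
    -- themselves.
    grid : List (List (List A))
    grid = List.tabulate rows

module GridEmbedding
  {ℓ} {A : Set} (R : A → A → Set ℓ) {m n} (addr : Fin m → ℕ × ℕ) (addr′ : Fin n → ℕ × ℕ)
  (tag : Fin m → A) (tag′ : Fin n → A)
  (s : Sublist (Sublist (Sublist R)) (Grid.grid addr tag) (Grid.grid addr′ tag′))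
  where
  private
    module G = Grid addr
    module H = Grid addr′

    σ : Fin G.B → Fin H.B
    σ = proj₁ (tabulate-sublist {f = G.rows tag} s)

    σ-mono : StrictMono σ
    σ-mono = proj₁ (proj₂ (tabulate-sublist {f = G.rows tag} s))

    inRow : ∀ β → Σ (Fin G.C → Fin H.C) λ τ → StrictMono τ ×
                  (∀ γ → Sublist R (G.cells tag β γ) (H.cells tag′ (σ β) (τ γ)))
    inRow β = tabulate-sublist {f = G.cells tag β} (proj₂ (proj₂ (tabulate-sublist {f = G.rows tag} s)) β)

    τ : Fin G.B → Fin G.C → Fin H.C
    τ β = proj₁ (inRow β)

    inCell : ∀ β γ → Σ (Fin (length (G.cell β γ)) → Fin (length (H.cell (σ β) (τ β γ)))) λ ρ →
                     StrictMono ρ × (∀ i → R (tag (List.lookup (G.cell β γ) i)) (tag′ (List.lookup (H.cell (σ β) (τ β γ)) (ρ i))))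
    inCell β γ = tabulate-sublist {f = tag ∘ List.lookup (G.cell β γ)} (proj₂ (proj₂ (inRow β)) γ)

    -- The cell is a parameter of its own, so that two vertices of one cell are sent through
    -- literally the same map and its injectivity applies; `image-irrelevant` returns to the cell of
    -- `v`.
    image : ∀ v {β γ} → G.level v ≡ β → G.block v ≡ γ → Fin n
    image v {β} {γ} p q = List.lookup (H.cell (σ β) (τ β γ)) (proj₁ (inCell β γ) (G.position v p q))

    image-irrelevant : ∀ v {β γ} (p : G.level v ≡ β) (q : G.block v ≡ γ) → image v p q ≡ image v refl refl
    image-irrelevant v refl refl = refl

    image-injective : ∀ u v {β γ} (p : G.level u ≡ β) (q : G.block u ≡ γ) (p′ : G.level v ≡ β) (q′ : G.block v ≡ γ) →
                      image u p q ≡ image v p′ q′ → u ≡ v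
    image-injective u v {β} {γ} p q p′ q′ eq =
      trans (G.lookup-position u p q)
        (trans (cong (List.lookup (G.cell β γ))
                 (strictMono⇒injective (proj₁ (proj₂ (inCell β γ)))
                   (lookup-injective (H.cell-unique (σ β) (τ β γ)) _ _ eq)))
               (sym (G.lookup-position v p′ q′)))

  f : Fin m → Fin n
  f v = image v refl refl

  f-rel : ∀ v → R (tag v) (tag′ (f v))
  f-rel v = subst (λ w → R (tag w) (tag′ (f v))) (sym (G.lookup-position v refl refl))
              (proj₂ (proj₂ (inCell (G.level v) (G.block v))) (G.position v refl refl))

  private
    level-f : ∀ v → H.b (f v) ≡ toℕ (σ (G.level v))
    level-f v = trans (sym (H.toℕ-level (f v))) (cong toℕ (proj₁ (H.at-lookup _ _ _)))

    block-f : ∀ v → H.c (f v) ≡ toℕ (τ (G.level v) (G.block v))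
    block-f v = trans (sym (H.toℕ-block (f v))) (cong toℕ (proj₂ (H.at-lookup (σ (G.level v)) _ _)))

    b-mono : ∀ u v → G.b u < G.b v → H.b (f u) < H.b (f v)
    b-mono u v u<v = subst₂ _<_ (sym (level-f u)) (sym (level-f v))
      (σ-mono _ _ (subst₂ _<_ (sym (G.toℕ-level u)) (sym (G.toℕ-level v)) u<v))

    level≡ : ∀ u v → G.b u ≡ G.b v → G.level u ≡ G.level v
    level≡ u v eq = toℕ-injective (trans (G.toℕ-level u) (trans eq (sym (G.toℕ-level v))))

    block≡ : ∀ u v → G.c u ≡ G.c v → G.block u ≡ G.block v
    block≡ u v eq = toℕ-injective (trans (G.toℕ-block u) (trans eq (sym (G.toℕ-block v))))

    -- Equality of levels is required because `τ` is chosen for each level separately; blocks of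
    -- different levels may collide, which `rel` does not notice.
    c-injective : ∀ u v → G.b u ≡ G.b v → H.c (f u) ≡ H.c (f v) → G.c u ≡ G.c v
    c-injective u v b≡ c≡ = trans (sym (G.toℕ-block u)) (trans (cong toℕ block-≡) (G.toℕ-block v))
      where
      block-≡ : G.block u ≡ G.block v
      block-≡ = strictMono⇒injective (proj₁ (proj₂ (inRow (G.level u))))
        (toℕ-injective (trans (sym (block-f u)) (trans c≡ (trans (block-f v)
          (cong (λ β → toℕ (τ β (G.block v))) (sym (level≡ u v b≡)))))))

  f-resp-rel : ∀ u v → rel (addr u) (addr v) ≡ rel (addr′ (f u)) (addr′ (f v))
  f-resp-rel u v with <-cmp (G.b u) (G.b v) | G.c u ℕ.≟ G.c v
  ... | tri< u<v _ _ | _ = trans (rel-before {addr u} u<v) (sym (rel-before {addr′ (f u)} (b-mono u v u<v)))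
  ... | tri> _ _ v<u | _ = trans (rel-after {addr u} v<u) (sym (rel-after {addr′ (f u)} (b-mono v u v<u)))
  ... | tri≈ _ b≡ _ | yes c≡ = trans (rel-same {addr u} b≡ c≡) (sym (rel-same {addr′ (f u)}
          (trans (level-f u) (trans (cong (toℕ ∘ σ) (level≡ u v b≡)) (sym (level-f v))))
          (trans (block-f u) (trans (cong₂ (λ β γ → toℕ (τ β γ)) (level≡ u v b≡) (block≡ u v c≡)) (sym (block-f v))))))
  ... | tri≈ _ b≡ _ | no c≢ = trans (rel-apart {addr u} b≡ c≢) (sym (rel-apart {addr′ (f u)}
          (trans (level-f u) (trans (cong (toℕ ∘ σ) (level≡ u v b≡)) (sym (level-f v))))
          (c≢ ∘ c-injective u v b≡)))

  f-injective : ∀ {u v} → f u ≡ f v → u ≡ v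
  f-injective {u} {v} fu≡fv with <-cmp (G.b u) (G.b v)
  ... | tri< u<v _ _ = ⊥-elim (<-irrefl (cong H.b fu≡fv) (b-mono u v u<v))
  ... | tri> _ _ v<u = ⊥-elim (<-irrefl (cong H.b (sym fu≡fv)) (b-mono v u v<u))
  ... | tri≈ _ b≡ _ = image-injective u v (level≡ u v b≡) (block≡ u v (c-injective u v b≡ (cong H.c fu≡fv))) refl refl
          (trans (image-irrelevant u _ _) fu≡fv)

module Represented
  {a ℓ} (em : ExcludedMiddle ℓ) {W : Set a} {_≤W_ : W → W → Set ℓ} (wqo : IsWellQuasiOrder _≤W_)
  (S : Scheme) (G : ℕ → LabelledGraph W) (rep : ∀ i → Rep S (graph (G i)) (λ _ → ⊥))
  where
  open WQO em
  open IsWellQuasiOrder wqo using (good)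
  open Scheme S
  private module ≤W = IsPreorder (IsWellQuasiOrder.isPreorder wqo)

  private
    -- A vertex with the index of its graph, instead of a pair of type and label: the alphabet stays
    -- in `Set` whatever the level of `W`.
    Letter : Set
    Letter = Σ ℕ λ i → Vertex (graph (G i))

    label′ : Letter → W
    label′ (i , v) = label (G i) v

    type′ : Letter → Type
    type′ (i , v) = Rep.type (rep i) v

    _≼_ : Letter → Letter → Set ℓ
    x ≼ y = type′ x ≡ type′ y × label′ x ≤W label′ y

    ≼-trans : ∀ {x y z} → x ≼ y → y ≼ z → x ≼ z
    ≼-trans (p , q) (p′ , q′) = trans p p′ , ≤W.trans q q′

    -- Along a subsequence with ascending labels, two terms share their type as soon as there are
    -- more terms than types.
    ≼-good : Good _≼_
    ≼-good x with ascending {R = λ x y → label′ x ≤W label′ y} ≤W.trans (good ∘ (label′ ∘_)) x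
    ... | ψ , asc with pigeonhole (ℕₚ.n<1+n (proj₁ finite)) (λ i → proj₁ (proj₂ finite) (type′ (x (ψ (toℕ i)))))
    ... | i , j , i<j , eq = _ , _ , proj₁ (asc i<j) , proj₂ (proj₂ finite) eq , proj₂ (asc i<j)

    gridOf : ℕ → List (List (List Letter))
    gridOf i = Grid.grid (Rep.addr (rep i)) (i ,_)

    grid-good : Good (Sublist (Sublist (Sublist _≼_)))
    grid-good = higman (Sublistₚ.trans (Sublistₚ.trans ≼-trans))
                  (higman (Sublistₚ.trans ≼-trans) (higman ≼-trans ≼-good))

  comparable : ∃₂ λ i j → i < j × LabelledInducedSubgraph _≤W_ (G i) (G j)
  comparable with grid-good gridOf
  ... | i , j , i<j , s = i , j , i<j , E.f
      , record { injective = E.f-injective ; adj-≡ = adj-≡ }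
      , λ v → proj₂ (E.f-rel v)
    where
    module E = GridEmbedding _≼_ (Rep.addr (rep i)) (Rep.addr (rep j)) (i ,_) (j ,_) s
    module Gᵢ = Graph (graph (G i))
    module Gⱼ = Graph (graph (G j))

    adj-≡ : ∀ u v → Gᵢ.adj u v ≡ Gⱼ.adj (E.f u) (E.f v)
    adj-≡ u v with u Fin.≟ v
    ... | yes refl = trans (Gᵢ.adj-irrefl u) (sym (Gⱼ.adj-irrefl (E.f u)))
    ... | no u≢v = begin
      Gᵢ.adj u v                                 ≡⟨ Rep.adj-φ (rep i) u v (λ ()) (λ ()) u≢v ⟩
      φ (tyᵢ u) (tyᵢ v) _                        ≡⟨ cong (φ (tyᵢ u) (tyᵢ v)) (E.f-resp-rel u v) ⟩
      φ (tyᵢ u) (tyᵢ v) r                        ≡⟨ cong₂ (λ s t → φ s t r) (proj₁ (E.f-rel u)) (proj₁ (E.f-rel v)) ⟩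
      φ (tyⱼ (E.f u)) (tyⱼ (E.f v)) r            ≡⟨ Rep.adj-φ (rep j) _ _ (λ ()) (λ ()) (u≢v ∘ E.f-injective) ⟨
      Gⱼ.adj (E.f u) (E.f v)                     ∎
      where
      open ≡-Reasoning
      tyᵢ = Rep.type (rep i)
      tyⱼ = Rep.type (rep j)
      r = rel (Rep.addr (rep j) (E.f u)) (Rep.addr (rep j) (E.f v))

-- Finite types and operations on schemes

finite-⊤ : Finite ⊤
finite-⊤ = 1 , (λ _ → zero) , λ _ → refl

finite-Bool : Finite Bool
finite-Bool = 2 , code , λ { {true} {true} _ → refl ; {false} {false} _ → refl }
  where
  code : Bool → Fin 2
  code false = zero
  code true  = suc zero

finite-Fin : ∀ n → Finite (Fin n)
finite-Fin n = n , (λ i → i) , λ eq → eq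

finite-× : ∀ {S T} → Finite S → Finite T → Finite (S × T)
finite-× (m , f , f-inj) (n , g , g-inj) = m ℕ.* n , (λ (s , t) → combine (f s) (g t))
  , λ eq → let p , q = combine-injective _ _ _ _ eq in cong₂ _,_ (f-inj p) (g-inj q)

finite-⊎ : ∀ {S T} → Finite S → Finite T → Finite (S ⊎ T)
finite-⊎ {S} {T} (m , f , f-inj) (n , g , g-inj) = m ℕ.+ n , join m n ∘ Sum.map f g , inj
  where
  split : ∀ {x y : Fin m ⊎ Fin n} → join m n x ≡ join m n y → x ≡ y
  split {x} {y} eq = trans (sym (splitAt-join m n x)) (trans (cong (Fin.splitAt m) eq) (splitAt-join m n y))

  inj : ∀ {x y : S ⊎ T} → join m n (Sum.map f g x) ≡ join m n (Sum.map f g y) → x ≡ y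
  inj {inj₁ _} {inj₁ _} eq = cong inj₁ (f-inj (inj₁-injective (split eq)))
  inj {inj₂ _} {inj₂ _} eq = cong inj₂ (g-inj (inj₂-injective (split eq)))
  inj {inj₁ _} {inj₂ _} eq with split {inj₁ _} {inj₂ _} eq
  ... | ()
  inj {inj₂ _} {inj₁ _} eq with split {inj₂ _} {inj₁ _} eq
  ... | ()

finite-Vec : ∀ n → Finite (Vec Bool n)
finite-Vec zero = 1 , (λ _ → zero) , λ { {[]} {[]} _ → refl }
finite-Vec (suc n) with finite-× finite-Bool (finite-Vec n)
... | k , code , inj = k , (λ { (b ∷ bs) → code (b , bs) })
    , λ { {_ ∷ _} {_ ∷ _} eq → cong (λ (b , bs) → b ∷ bs) (inj eq) }

-- The extra type inj₁ tt is that of a deleted vertex; the Boolean records adjacency to it.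
addVertex : Scheme → Scheme
addVertex S = record
  { Type = ⊤ ⊎ Type × Bool
  ; finite = finite-⊎ finite-⊤ (finite-× finite finite-Bool)
  ; φ = λ { (inj₁ _) (inj₁ _) _ → false
          ; (inj₁ _) (inj₂ (_ , b)) _ → b
          ; (inj₂ (_ , b)) (inj₁ _) _ → b
          ; (inj₂ (s , _)) (inj₂ (t , _)) r → φ s t r } }
  where open Scheme S

opaque
  addVertices : ℕ → Scheme → Scheme
  addVertices zero    S = S
  addVertices (suc n) S = addVertices n (addVertex S)

infixr 5 _⊕ˢ_

opaque
  _⊕ˢ_ : Scheme → Scheme → Scheme
  S ⊕ˢ T = record
    { Type = S.Type ⊎ T.Type
    ; finite = finite-⊎ S.finite T.finite
    ; φ = λ { (inj₁ s) (inj₁ t) r → S.φ s t r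
            ; (inj₂ s) (inj₂ t) r → T.φ s t r
            ; _ _ _ → false } }
    where
    module S = Scheme S
    module T = Scheme T

clusterScheme : (T : Set) → Finite T → (T → T → Bool) → Scheme
clusterScheme T finite β = record
  { Type = T ; finite = finite ; φ = λ { s t same → not (β s t) ; s t _ → β s t } }

module _ {G : Graph} where
  open Graph G using (adj; adj-sym)

  weaken : ∀ {S D E} → (∀ {v} → D v → E v) → Rep S G D → Rep S G E
  weaken D⊆E ρ = record { Rep ρ ; adj-φ = λ u v ¬u ¬v → Rep.adj-φ ρ u v (¬u ∘ D⊆E) (¬v ∘ D⊆E) }

  opaque
    unfolding _⊕ˢ_

    inˡ : ∀ {S T D} → Rep S G D → Rep (S ⊕ˢ T) G D
    inˡ ρ = record { type = inj₁ ∘ Rep.type ρ ; addr = Rep.addr ρ ; adj-φ = Rep.adj-φ ρ }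
  
    inʳ : ∀ {S T D} → Rep T G D → Rep (S ⊕ˢ T) G D
    inʳ ρ = record { type = inj₂ ∘ Rep.type ρ ; addr = Rep.addr ρ ; adj-φ = Rep.adj-φ ρ }

  undelete : ∀ {S D} x → Rep S G (λ v → v ≡ x ⊎ D v) → Rep (addVertex S) G D
  undelete {S} {D} x ρ = record { type = type ; addr = Rep.addr ρ ; adj-φ = adj-φ }
    where
    open Scheme (addVertex S)
    type : Vertex G → Type
    type v with v Fin.≟ x
    ... | yes _ = inj₁ tt
    ... | no _ = inj₂ (Rep.type ρ v , adj v x)

    adj-φ : ∀ u v → ¬ D u → ¬ D v → u ≢ v → adj u v ≡ φ (type u) (type v) (rel (Rep.addr ρ u) (Rep.addr ρ v))
    adj-φ u v ¬u ¬v u≢v with u Fin.≟ x | v Fin.≟ x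
    ... | yes refl | yes refl = ⊥-elim (u≢v refl)
    ... | yes refl | no _ = adj-sym u v
    ... | no _ | yes refl = refl
    ... | no u≢x | no v≢x = Rep.adj-φ ρ u v Sum.[ u≢x , ¬u ] Sum.[ v≢x , ¬v ] u≢v

  -- Padding: the scheme then depends on the bound on the number of deleted vertices, not on the
  -- number deleted from a particular graph.
  undelete-none : ∀ {S D} → Rep S G D → Rep (addVertex S) G D
  undelete-none ρ = record { type = λ v → inj₂ (Rep.type ρ v , false) ; addr = Rep.addr ρ ; adj-φ = Rep.adj-φ ρ }

  opaque
    unfolding addVertices

    undelete-list : ∀ {S} n (xs : List (Vertex G)) → length xs ≤ n → Rep S G (_∈ xs) → Rep (addVertices n S) G (λ _ → ⊥)
    undelete-list zero [] _ ρ = weaken (λ ()) ρ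
    undelete-list (suc n) [] _ ρ = undelete-list n [] z≤n (undelete-none ρ)
    undelete-list (suc n) (x ∷ xs) (s≤s len) ρ =
      undelete-list n xs len (undelete x (weaken (λ { (here eq) → inj₁ eq ; (there v∈) → inj₂ v∈ }) ρ))

-- Sets of bounded size

Small : {V : Set} → ℕ → (V → Set) → Set
Small {V} n D = Σ (List V) λ xs → length xs ≤ n × (∀ {v} → D v → v ∈ xs)

module _ {V : Set} where
  small-list : ∀ (xs : List V) → Small (length xs) (_∈ xs)
  small-list xs = xs , ≤-refl , λ v∈ → v∈

  small-⊆ : ∀ {n} {D E : V → Set} → (∀ {v} → D v → E v) → Small n E → Small n D
  small-⊆ D⊆E (xs , len , cover) = xs , len , cover ∘ D⊆E

  small-∪ : ∀ {m n} {D E : V → Set} → Small m D → Small n E → Small (m ℕ.+ n) (λ v → D v ⊎ E v)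
  small-∪ (xs , len , cover) (ys , len′ , cover′) = xs ++ ys
    , subst (_≤ _) (sym (length-++ xs)) (ℕₚ.+-mono-≤ len len′)
    , λ { (inj₁ d) → ∈-++⁺ˡ (cover d) ; (inj₂ e) → ∈-++⁺ʳ xs (cover′ e) }

  small-⋃ : ∀ {I : Set} {n} {D : I → V → Set} (is : List I) → (∀ i → Small n (D i)) →
            Small (length is ℕ.* n) (λ v → ∃ λ i → i ∈ is × D i v)
  small-⋃ [] _ = [] , z≤n , λ { (_ , () , _) }
  small-⋃ (i ∷ is) small = small-⊆
    (λ { (_ , here refl , d) → inj₁ d ; (j , there j∈ , d) → inj₂ (j , j∈ , d) })
    (small-∪ (small i) (small-⋃ is small))

small-≤ : ∀ {V : Set} {m n} {D : V → Set} → m ≤ n → Small m D → Small n D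
small-≤ m≤n (xs , len , cover) = xs , ≤-trans len m≤n , cover

undelete-small : ∀ {S} {G : Graph} {D} n → Small n D → Rep S G D → Rep (addVertices n S) G (λ _ → ⊥)
undelete-small n (xs , len , cover) ρ = undelete-list n xs len (weaken cover ρ)

-- Deviating pairs that form disjoint cliques

module Classical (em : ExcludedMiddle 0ℓ) where

  least : ∀ {n} → (Fin n → Set) → ℕ
  least {zero} Q = 0
  least {suc n} Q with em {Q zero}
  ... | yes _ = 0
  ... | no _ = suc (least (Q ∘ suc))

  least-cong : ∀ {n} {P Q : Fin n → Set} → (∀ i → P i → Q i) → (∀ i → Q i → P i) → least P ≡ least Q
  least-cong {zero} _ _ = refl
  least-cong {suc n} {P} {Q} P⊆Q Q⊆P with em {P zero} | em {Q zero}
  ... | yes _ | yes _ = refl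
  ... | yes p | no ¬q = ⊥-elim (¬q (P⊆Q zero p))
  ... | no ¬p | yes q = ⊥-elim (¬p (Q⊆P zero q))
  ... | no _ | no _ = cong suc (least-cong (P⊆Q ∘ suc) (Q⊆P ∘ suc))

  least-∈ : ∀ {n} {Q : Fin n → Set} → ∃ Q → ∃ λ i → toℕ i ≡ least Q × Q i
  least-∈ {suc n} {Q} (i , q) with em {Q zero}
  ... | yes q₀ = zero , refl , q₀
  least-∈ {suc n} {Q} (zero , q) | no ¬q₀ = ⊥-elim (¬q₀ q)
  least-∈ {suc n} {Q} (suc i , q) | no _ with least-∈ {Q = Q ∘ suc} (i , q)
  ... | j , eq , qj = suc j , cong suc eq , qj

  module _ {G : Graph} where
    open Graph G using (adj; adj-sym)

    -- With equality added, `H` is an equivalence relation outside `D`. Its classes become the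
    -- blocks of a single level, and `same` reverses the default.
    cluster : ∀ {T} (finite : Finite T) (β : T → T → Bool) (κ : Vertex G → T) {D : Vertex G → Set} →
      (∀ s t → β s t ≡ β t s) →
      let H = λ u v → adj u v ≡ not (β (κ u) (κ v)) in
      (∀ {u v w} → ¬ D u → ¬ D v → ¬ D w → H u v → H v w → u ≢ w → H u w) →
      Rep (clusterScheme T finite β) G D
    cluster {T} finite β κ {D} β-sym H-trans = record
      { type = κ ; addr = λ v → 0 , block v ; adj-φ = adj-φ }
      where
      H : Vertex G → Vertex G → Set
      H u v = adj u v ≡ not (β (κ u) (κ v))

      H-sym : ∀ {u v} → H u v → H v u
      H-sym {u} {v} h = trans (adj-sym v u) (trans h (cong not (β-sym (κ u) (κ v))))

      Near : Vertex G → Vertex G → Set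
      Near u w = ¬ D w × (u ≡ w ⊎ H u w)

      -- The smallest member outside `D` names the clique of `u`.
      block : Vertex G → ℕ
      block u = least (Near u)

      near-trans : ∀ {u v w} → ¬ D u → ¬ D v → H u v → Near v w → Near u w
      near-trans ¬u ¬v h (¬w , inj₁ refl) = ¬w , inj₂ h
      near-trans {u} {v} {w} ¬u ¬v h (¬w , inj₂ h′) with u Fin.≟ w
      ... | yes u≡w = ¬w , inj₁ u≡w
      ... | no u≢w = ¬w , inj₂ (H-trans ¬u ¬v ¬w h h′ u≢w)

      near⇒H : ∀ {u v w} → ¬ D u → ¬ D v → u ≢ v → Near u w → Near v w → H u v
      near⇒H ¬u ¬v u≢v (_ , inj₁ refl) (_ , inj₁ refl) = ⊥-elim (u≢v refl)
      near⇒H ¬u ¬v u≢v (_ , inj₁ refl) (_ , inj₂ h) = H-sym h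
      near⇒H ¬u ¬v u≢v (_ , inj₂ h) (_ , inj₁ refl) = h
      near⇒H ¬u ¬v u≢v (¬w , inj₂ h) (_ , inj₂ h′) = H-trans ¬u ¬w ¬v h (H-sym h′) u≢v

      block-≡⇒H : ∀ {u v} → ¬ D u → ¬ D v → u ≢ v → block u ≡ block v → H u v
      block-≡⇒H {u} {v} ¬u ¬v u≢v eq
        with least-∈ {Q = Near u} (u , ¬u , inj₁ refl) | least-∈ {Q = Near v} (v , ¬v , inj₁ refl)
      ... | i , i≡ , near-u | j , j≡ , near-v with toℕ-injective (trans i≡ (trans eq (sym j≡)))
      ... | refl = near⇒H ¬u ¬v u≢v near-u near-v

      adj-φ : ∀ u v → ¬ D u → ¬ D v → u ≢ v →
              adj u v ≡ Scheme.φ (clusterScheme T finite β) (κ u) (κ v) (rel (0 , block u) (0 , block v))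
      adj-φ u v ¬u ¬v u≢v with block u ℕ.≟ block v
      ... | yes eq rewrite rel-same {0 , block u} {0 , block v} refl eq = block-≡⇒H ¬u ¬v u≢v eq
      ... | no neq rewrite rel-apart {0 , block u} {0 , block v} refl neq with adj u v ≟ᵇ not (β (κ u) (κ v))
      ... | yes h = ⊥-elim (neq (least-cong {P = Near u} {Near v} (λ _ → near-trans ¬v ¬u (H-sym h)) (λ _ → near-trans ¬u ¬v h)))
      ... | no ¬h = trans (¬-not ¬h) (not-involutive _)

-- Search for forbidden configurations

-- Strictly triangular adjacency matrices: each row lists the adjacencies of a vertex to the later ones.
Tri : ℕ → Set
Tri zero    = ⊤
Tri (suc n) = Vec Bool n × Tri n

entry : ∀ {n} → Tri n → Fin n → Fin n → Bool
entry (r , M) zero    zero    = false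
entry (r , M) zero    (suc j) = lookup r j
entry (r , M) (suc i) zero    = lookup r i
entry (r , M) (suc i) (suc j) = entry M i j

anyFin : ∀ {n} → (Fin n → Bool) → Bool
anyFin {zero}  f = false
anyFin {suc n} f = f zero ∨ anyFin (f ∘ suc)

fits : ∀ {k n} → Tri n → Vec Bool k → Vec (Fin n) k → Fin n → Bool
fits M []      []       i = true
fits M (b ∷ r) (j ∷ js) i = not (does (i Fin.≟ j)) ∧ does (entry M i j ≟ᵇ b) ∧ fits M r js i

-- The continuation makes this a backtracking search: the last vertices of the pattern are placed
-- first, and a candidate that does not fit cuts off all its extensions.
someCopy : ∀ {k n} → Tri k → Tri n → (Vec (Fin n) k → Bool) → Bool
someCopy {zero}  P       M κ = κ []
someCopy {suc k} (r , P) M κ = someCopy P M λ js → anyFin λ i → fits M r js i ∧ κ (i ∷ js)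

∧-true : ∀ {x y} → x ∧ y ≡ true → x ≡ true × y ≡ true
∧-true {true} eq = refl , eq

anyFin-true : ∀ {n} (f : Fin n → Bool) → anyFin f ≡ true → ∃ λ i → f i ≡ true
anyFin-true {suc n} f eq with f zero in eq₀
... | true = zero , eq₀
... | false with anyFin-true (f ∘ suc) eq
... | i , eqᵢ = suc i , eqᵢ

Pattern : Set
Pattern = Σ ℕ Tri

excluded : List Pattern → ∀ {n} → Tri n → Bool
excluded []             M = false
excluded ((_ , P) ∷ Ps) M = someCopy P M (λ _ → true) ∨ excluded Ps M

-- A record, so that the unifier never unfolds the search.
record Excluded (Ps : List Pattern) {n} (M : Tri n) : Set where
  constructor by-search
  field
    found : excluded Ps M ≡ true

complete : ∀ n → Tri n
complete zero    = tt
complete (suc n) = replicate n true , complete n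

diamond : Tri 4
diamond = false ∷ true ∷ true ∷ [] , complete 3

P₂+P₃ : Tri 5
P₂+P₃ = true ∷ false ∷ false ∷ false ∷ []
      , false ∷ false ∷ false ∷ []
      , false ∷ true ∷ []
      , true ∷ []
      , [] , tt

-- Two triangles together with a partial matching between them.
triangles : Bool → Bool → Bool → Tri 6
triangles x y z = true ∷ true ∷ z ∷ false ∷ false ∷ []
                , true ∷ false ∷ y ∷ false ∷ []
                , false ∷ false ∷ x ∷ []
                , complete 3

C₅ : Tri 5
C₅ = true ∷ false ∷ false ∷ true ∷ []
   , true ∷ false ∷ false ∷ []
   , true ∷ false ∷ []
   , true ∷ []
   , [] , tt

Distinct : {V : Set} → ∀ {n} → Vec V n → Set
Distinct []       = ⊤
Distinct (v ∷ vs) = Allᵛ.All (v ≢_) vs × Distinct vs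

lookup-distinct : {V : Set} → ∀ {n} {vs : Vec V n} → Distinct vs → ∀ i j → lookup vs i ≡ lookup vs j → i ≡ j
lookup-distinct {vs = v ∷ vs} _ zero zero eq = refl
lookup-distinct {vs = v ∷ vs} (v∉ , _) zero (suc j) eq = ⊥-elim (lookup⁺ v∉ j eq)
lookup-distinct {vs = v ∷ vs} (v∉ , _) (suc i) zero eq = ⊥-elim (lookup⁺ v∉ i (sym eq))
lookup-distinct {vs = v ∷ vs} (_ , d) (suc i) (suc j) eq = cong suc (lookup-distinct d i j eq)

module _ (G : Graph) where
  open Graph G using (adj; adj-sym; adj-irrefl)

  matrix : ∀ {n} → Vec (Vertex G) n → Tri n
  matrix []       = tt
  matrix (v ∷ vs) = map (adj v) vs , matrix vs

  entry-matrix : ∀ {n} (vs : Vec (Vertex G) n) i j → entry (matrix vs) i j ≡ adj (lookup vs i) (lookup vs j)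
  entry-matrix (v ∷ vs) zero    zero    = sym (adj-irrefl v)
  entry-matrix (v ∷ vs) zero    (suc j) = lookup-map j vs
    where
    lookup-map : ∀ {n} j (vs : Vec (Vertex G) n) → lookup (map (adj v) vs) j ≡ adj v (lookup vs j)
    lookup-map zero (w ∷ vs) = refl
    lookup-map (suc j) (w ∷ vs) = lookup-map j vs
  entry-matrix (v ∷ vs) (suc i) zero    = trans (entry-matrix (v ∷ vs) zero (suc i)) (adj-sym v _)
  entry-matrix (v ∷ vs) (suc i) (suc j) = entry-matrix vs i j

  Avoids : Pattern → Set
  Avoids (n , P) = (ws : Vec (Vertex G) n) → Distinct ws → matrix ws ≢ P

  Contains : ∀ {n} → Tri n → Set
  Contains {n} P = Σ (Vec (Vertex G) n) λ ws → Distinct ws × matrix ws ≡ P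

  module _ {n} {vs : Vec (Vertex G) n} (distinct : Distinct vs) where
    fits-sound : ∀ {k} (r : Vec Bool k) js i → fits (matrix vs) r js i ≡ true →
      Allᵛ.All (lookup vs i ≢_) (map (lookup vs) js) × map (adj (lookup vs i)) (map (lookup vs) js) ≡ r
    fits-sound [] [] i _ = [] , refl
    fits-sound (b ∷ r) (j ∷ js) i eq with i Fin.≟ j
    ... | no i≢j with entry (matrix vs) i j ≟ᵇ b
    ... | yes e with fits-sound r js i eq
    ... | i∉ , row = (i≢j ∘ lookup-distinct distinct i j) ∷ i∉
                   , cong₂ _∷_ (trans (sym (entry-matrix vs i j)) e) row

    someCopy-sound : ∀ {k} (P : Tri k) κ → someCopy P (matrix vs) κ ≡ true →
      ∃ λ js → Distinct (map (lookup vs) js) × matrix (map (lookup vs) js) ≡ P × κ js ≡ true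
    someCopy-sound {zero} P κ eq = [] , tt , refl , eq
    someCopy-sound {suc k} (r , P) κ eq with someCopy-sound P _ eq
    ... | js , d , m , eq′ with anyFin-true _ eq′
    ... | i , eq″ with ∧-true eq″
    ... | eq₁ , eq₂ with fits-sound r js i eq₁
    ... | i∉ , row = i ∷ js , (i∉ , d) , cong₂ _,_ row m , eq₂

    excluded-sound : ∀ {Ps} → All Avoids Ps → excluded Ps (matrix vs) ≢ true
    excluded-sound {(_ , P) ∷ Ps} (avoids ∷ all) eq with someCopy P (matrix vs) (λ _ → true) in eq′
    ... | false = excluded-sound all eq
    ... | true with someCopy-sound P (λ _ → true) eq′
    ... | js , d , m , _ = avoids _ d m

    ¬excluded : ∀ {Ps} → All Avoids Ps → ¬ Excluded Ps (matrix vs)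
    ¬excluded avoids (by-search found) = excluded-sound avoids found

  contains⇒induced : (H : Graph) → ∀ {n} {P : Tri n} (π : Vertex H → Fin n) →
    (∀ {u v} → π u ≡ π v → u ≡ v) → (∀ u v → Graph.adj H u v ≡ entry P (π u) (π v)) →
    Contains P → H IsInducedSubgraphOf G
  contains⇒induced H {P = P} π π-inj adj-π (ws , d , refl) = lookup ws ∘ π , record
    { injective = λ eq → π-inj (lookup-distinct d _ _ eq)
    ; adj-≡ = λ u v → trans (adj-π u v) (entry-matrix ws (π u) (π v)) }

  free⇒avoids : Free (complement (2 · P 1 ⊕ P 2) ∷ (P 2 ⊕ P 3) ∷ []) G →
                Avoids (-, diamond) × Avoids (-, P₂+P₃)
  free⇒avoids (¬diamond ∷ ¬P₂+P₃ ∷ []) =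
      (λ ws d m → ¬diamond (contains⇒induced _ {P = diamond} π₁
        (λ {u} {v} → from-yes (all? λ u → all? λ v → (π₁ u Fin.≟ π₁ v) →-dec (u Fin.≟ v)) u v)
        (from-yes (all? λ u → all? λ v → Graph.adj (complement (2 · P 1 ⊕ P 2)) u v ≟ᵇ entry diamond (π₁ u) (π₁ v)))
        (ws , d , m)))
    , (λ ws d m → ¬P₂+P₃ (contains⇒induced _ {P = P₂+P₃} π₂
        (λ {u} {v} → from-yes (all? λ u → all? λ v → (π₂ u Fin.≟ π₂ v) →-dec (u Fin.≟ v)) u v)
        (from-yes (all? λ u → all? λ v → Graph.adj (P 2 ⊕ P 3) u v ≟ᵇ entry P₂+P₃ (π₂ u) (π₂ v)))
        (ws , d , m)))
    where
    -- Complementation turns the edge of `P 2` into the nonadjacent pair, which `diamond` lists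
    -- first.
    π₁ : Fin 4 → Fin 4
    π₁ = lookup (2F ∷ 3F ∷ 0F ∷ 1F ∷ [])
    -- The pattern `P₂+P₃` lists the middle vertex of the path last.
    π₂ : Fin 5 → Fin 5
    π₂ = lookup (0F ∷ 1F ∷ 2F ∷ 4F ∷ 3F ∷ [])

-- Graphs containing an anchor

allVecs : ∀ n → List (Vec Bool n)
allVecs zero    = [] ∷ []
allVecs (suc n) = List.map (false ∷_) (allVecs n) ++ List.map (true ∷_) (allVecs n)

∈-allVecs : ∀ {n} (c : Vec Bool n) → c ∈ allVecs n
∈-allVecs [] = here refl
∈-allVecs (false ∷ c) = ∈-++⁺ˡ (∈-map⁺ (false ∷_) (∈-allVecs c))
∈-allVecs {suc n} (true ∷ c) = ∈-++⁺ʳ (List.map (false ∷_) (allVecs n)) (∈-map⁺ (true ∷_) (∈-allVecs c))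

every : {A : Set} → (A → Bool) → List A → Bool
every p []       = true
every p (x ∷ xs) = p x ∧ every p xs

every-∈ : ∀ {A : Set} {p : A → Bool} {xs x} → every p xs ≡ true → x ∈ xs → p x ≡ true
every-∈ eq (here refl) = proj₁ (∧-true eq)
every-∈ eq (there x∈)  = every-∈ (proj₂ (∧-true eq)) x∈

countFin : ∀ {n} → (Fin n → Bool) → ℕ
countFin {zero}  f = 0
countFin {suc n} f = (if f zero then 1 else 0) + countFin (f ∘ suc)

sumFin : ∀ {n} → (Fin n → ℕ) → ℕ
sumFin {zero}  f = 0
sumFin {suc n} f = f zero + sumFin (f ∘ suc)

-- Vertices outside an anchor F fall into classes according to their neighbours in F. A class is big
-- if it may contain two nonadjacent vertices.
module Anchor (Ps : List Pattern) {n} (F : Tri n) where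
  Class : Set
  Class = Vec Bool n

  threeEdges : Class → Class → Bool
  threeEdges c d = sumFin (λ i → countFin λ j → lookup c i ∧ lookup d j ∧ entry F i j) ≡ᵇ 3

  -- The default adjacency between two big classes, from which few pairs deviate. That it can be read
  -- off from the number of edges of F between c and d is an empirical fact, confirmed by check.
  β : Class → Class → Bool
  β c d = threeEdges c d ∧ threeEdges d c

  big : Class → Bool
  big c = not (excluded Ps (false ∷ c , c , F))

  bigs : List Class
  bigs = List.filter (λ c → big c ≟ᵇ true) (allVecs n)

  -- A vertex of class c deviates from two nonadjacent vertices of class d.
  starExcluded : Class → Class → Bool
  starExcluded c d = excluded Ps (false ∷ not (β d c) ∷ d , not (β d c) ∷ d , c , F)

  -- Two paths of deviating pairs, each with middle vertex in c and ends in d and e; all other pairs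
  -- follow the default.
  twoPathsExcluded : Class → Class → Class → Bool
  twoPathsExcluded c d e = excluded Ps
    ( β e d ∷ not (β e c) ∷ β e e ∷ β e d ∷ β e c ∷ e
    , not (β d c) ∷ β d e ∷ β d d ∷ β d c ∷ d
    , β c e ∷ β c d ∷ β c c ∷ c
    , β e d ∷ not (β e c) ∷ e
    , not (β d c) ∷ d
    , c , F)

  checkOn : List Class → Bool
  checkOn cs = every (λ c → every (λ d → starExcluded c d ∧ every (twoPathsExcluded c d) cs) cs) cs

  check : Bool
  check = checkOn bigs

  -- The number of vertices that may have to be deleted when there is no clique of size m.
  deletions : ℕ → ℕ
  deletions m = n + length (allVecs n) ℕ.* m
              + length (cartesianProduct bigs (cartesianProduct bigs bigs)) ℕ.* (3 ℕ.* (1 + length bigs ℕ.* m))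

  opaque
    scheme : ℕ → Scheme
    scheme m = addVertices (deletions m) (clusterScheme Class (finite-Vec n) β)

-- A record, so that the unifier never evaluates the check.
record Checked (Ps : List Pattern) {n} (F : Tri n) : Set where
  constructor by-check
  field
    passed : Anchor.check Ps F ≡ true

∈-or-fresh : ∀ {k n} (v : Fin k) (vs : Vec (Fin k) n) → v ∈ toList vs ⊎ Allᵛ.All (v ≢_) vs
∈-or-fresh v [] = inj₂ []
∈-or-fresh v (w ∷ vs) with v Fin.≟ w | ∈-or-fresh v vs
... | yes v≡w | _ = inj₁ (here v≡w)
... | no _ | inj₁ v∈ = inj₁ (there v∈)
... | no v≢w | inj₂ v∉ = inj₂ (v≢w ∷ v∉)

module Anchored (em : ExcludedMiddle 0ℓ) (G : Graph) where
  open Graph G using (adj; adj-sym; adj-irrefl)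
  open Classical em

  -- Vertices are picked greedily; when no further one can be picked, those already picked are all
  -- of `D`.
  distinct-or-small : ∀ m (D : Vertex G → Set) → (Σ (Vec (Vertex G) m) λ ws → Distinct ws × Allᵛ.All D ws) ⊎ Small m D
  distinct-or-small zero D = inj₁ ([] , _ , [])
  distinct-or-small (suc m) D with distinct-or-small m D
  ... | inj₂ small = inj₂ (small-≤ (n≤1+n m) small)
  ... | inj₁ (ws , distinct , Dws) with em {∃ λ v → D v × Allᵛ.All (v ≢_) ws}
  ... | yes (v , Dv , v∉) = inj₁ (v ∷ ws , (v∉ , distinct) , Dv ∷ Dws)
  ... | no ¬v = inj₂ (toList ws , ≤-trans (≤-reflexive (length-toList ws)) (n≤1+n m) , cover)
    where
    cover : ∀ {v} → D v → v ∈ toList ws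
    cover {v} Dv with ∈-or-fresh v ws
    ... | inj₁ v∈ = v∈
    ... | inj₂ v∉ = ⊥-elim (¬v (v , Dv , v∉))

  module _ {m} (no-clique : Avoids G (m , complete m)) where
    clique-small : ∀ (D : Vertex G → Set) → (∀ {u v} → D u → D v → u ≢ v → adj u v ≡ true) → Small m D
    clique-small D clique with distinct-or-small m D
    ... | inj₂ small = small
    ... | inj₁ (ws , distinct , Dws) = ⊥-elim (no-clique ws distinct (complete-matrix ws distinct Dws))
      where
      row : ∀ {v k} (ws : Vec _ k) → D v → Allᵛ.All (v ≢_) ws → Allᵛ.All D ws → map (adj v) ws ≡ replicate k true
      row [] _ _ _ = refl
      row (w ∷ ws) Dv (v≢w ∷ v∉) (Dw ∷ Dws) = cong₂ _∷_ (clique Dv Dw v≢w) (row ws Dv v∉ Dws)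

      complete-matrix : ∀ {k} (ws : Vec _ k) → Distinct ws → Allᵛ.All D ws → matrix G ws ≡ complete k
      complete-matrix [] _ _ = refl
      complete-matrix (w ∷ ws) (w∉ , d) (Dw ∷ Dws) = cong₂ _,_ (row ws Dw w∉ Dws) (complete-matrix ws d Dws)

    module _ {Ps} (avoids : All (Avoids G) Ps) {n} (fs : Vec (Vertex G) n) (distinct : Distinct fs)
             (ok : Anchor.check Ps (matrix G fs) ≡ true) where
      open Anchor Ps (matrix G fs)

      private
        Fresh : Vertex G → Set
        Fresh v = Allᵛ.All (v ≢_) fs

        class : Vertex G → Class
        class v = map (adj v) fs

        Live : Vertex G → Set
        Live v = Fresh v × big (class v) ≡ true

        H : Vertex G → Vertex G → Set
        H u v = adj u v ≡ not (β (class u) (class v))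

        -- The conjunction of both orders in `β` reduces symmetry to commutativity, with no need to
        -- exchange the two summations in `threeEdges`.
        β-sym : ∀ c d → β c d ≡ β d c
        β-sym c d = ∧-comm (threeEdges c d) (threeEdges d c)

        ¬H⇒default : ∀ {u v} → ¬ H u v → adj u v ≡ β (class u) (class v)
        ¬H⇒default ¬h = trans (¬-not ¬h) (not-involutive _)

        H-sym : ∀ {u v} → H u v → H v u
        H-sym {u} {v} h = trans (adj-sym v u) (trans h (cong not (β-sym (class u) (class v))))

        live-∈ : ∀ {v} → Live v → class v ∈ bigs
        live-∈ {v} (_ , isBig) = ∈-filter⁺ (λ c → big c ≟ᵇ true) (∈-allVecs (class v)) isBig

        star-ok : ∀ {c d} → c ∈ bigs → d ∈ bigs → starExcluded c d ≡ true
        star-ok c∈ d∈ = proj₁ (∧-true (every-∈ (every-∈ ok c∈) d∈))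

        paths-ok : ∀ {c d e} → c ∈ bigs → d ∈ bigs → e ∈ bigs → twoPathsExcluded c d e ≡ true
        paths-ok c∈ d∈ e∈ = every-∈ (proj₂ (∧-true (every-∈ (every-∈ ok c∈) d∈))) e∈

        InSmallClass : Class → Vertex G → Set
        InSmallClass c v = Fresh v × class v ≡ c × big c ≡ false

        -- The search excludes a nonadjacent pair in a class that is not big, so the class is a
        -- clique.
        smallClass-small : ∀ c → Small m (InSmallClass c)
        smallClass-small c = clique-small (InSmallClass c) clique
          where
          clique : ∀ {u v} → InSmallClass c u → InSmallClass c v → u ≢ v → adj u v ≡ true
          clique {u} {v} (u∉ , refl , small) (v∉ , eq , _) u≢v with adj v u in adj-vu
          ... | true = trans (adj-sym u v) adj-vu
          ... | false = ⊥-elim (excluded-sound G {vs = v ∷ u ∷ fs} ((u≢v ∘ sym) ∷ v∉ , u∉ , distinct) avoids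
                  (trans (cong (excluded Ps) (cong₂ _,_ (cong₂ _∷_ adj-vu eq) refl))
                         (trans (sym (not-involutive _)) (cong not small))))

        Neighbour : Vertex G → Class → Vertex G → Set
        Neighbour q d v = Live q × Live v × class v ≡ d × v ≢ q × H v q

        -- Two nonadjacent vertices of class `d` that deviate from `q` form the configuration of
        -- `starExcluded`.
        neighbour-small : ∀ q d → Small m (Neighbour q d)
        neighbour-small q d = clique-small (Neighbour q d) clique
          where
          clique : ∀ {u v} → Neighbour q d u → Neighbour q d v → u ≢ v → adj u v ≡ true
          clique {u} {v} (q-live , u-live , refl , u≢q , hu) (_ , v-live , eq , v≢q , hv) u≢v with adj v u in adj-vu
          ... | true = trans (adj-sym u v) adj-vu
          ... | false = ⊥-elim (excluded-sound G {vs = v ∷ u ∷ q ∷ fs}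
                  ((u≢v ∘ sym) ∷ v≢q ∷ proj₁ v-live , u≢q ∷ proj₁ u-live , proj₁ q-live , distinct) avoids
                  (trans (cong (excluded Ps) (cong₂ _,_
                    (cong₂ _∷_ adj-vu (cong₂ _∷_ (trans hv (cong (λ c → not (β c (class q))) eq)) eq))
                    (cong₂ _,_ (cong (_∷ class u) hu) refl)))
                    (star-ok (live-∈ q-live) (live-∈ u-live))))

        Near : Vertex G → Vertex G → Set
        Near q v = v ≡ q ⊎ ∃ λ d → d ∈ bigs × Neighbour q d v

        -- The summand 1 is for `q` itself, and each big class contributes at most `m` vertices.
        near-small : ∀ q → Small (1 + length bigs ℕ.* m) (Near q)
        near-small q = small-∪ (small-⊆ here (small-list (q ∷ []))) (small-⋃ bigs (neighbour-small q))

        ¬near⇒default : ∀ {q v} → Live q → Live v → ¬ Near q v → adj v q ≡ β (class v) (class q)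
        ¬near⇒default ql vl ¬near = ¬H⇒default λ h → ¬near (inj₂ (_ , live-∈ vl , ql , vl , refl , ¬near ∘ inj₁ , h))

        record Path (c d e : Class) (u a b : Vertex G) : Set where
          field
            live-u : Live u
            live-a : Live a
            live-b : Live b
            class-u : class u ≡ c
            class-a : class a ≡ d
            class-b : class b ≡ e
            a≢u : a ≢ u
            b≢u : b ≢ u
            b≢a : b ≢ a
            H-au : H a u
            H-bu : H b u
            ¬H-ba : ¬ H b a

        Triple : Set
        Triple = Class × Class × Class

        SomePath : Triple → Set
        SomePath (c , d , e) = ∃ λ u → ∃₂ λ a b → Path c d e u a b

        -- All three vertices of one chosen path, not only its middle, because deviation from any of
        -- them has to be ruled out later.
        centres : Triple → List (Vertex G)
        centres t with em {SomePath t}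
        ... | yes (u , a , b , _) = u ∷ a ∷ b ∷ []
        ... | no _ = []

        centres-length : ∀ t → length (centres t) ≤ 3
        centres-length t with em {SomePath t}
        ... | yes _ = ≤-refl
        ... | no _ = z≤n

        triples : List Triple
        triples = cartesianProduct bigs (cartesianProduct bigs bigs)

        NearCentre : Triple → Vertex G → Set
        NearCentre t v = ∃ λ q → q ∈ centres t × Near q v

        nearCentre-small : ∀ t → Small (3 ℕ.* (1 + length bigs ℕ.* m)) (NearCentre t)
        nearCentre-small t = small-≤ (ℕₚ.*-monoˡ-≤ _ (centres-length t)) (small-⋃ (centres t) near-small)

        Deleted : Vertex G → Set
        Deleted v = (v ∈ toList fs ⊎ ∃ λ c → c ∈ allVecs n × InSmallClass c v) ⊎ ∃ λ t → t ∈ triples × NearCentre t v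

        deleted-small : Small (deletions m) Deleted
        deleted-small = small-∪ (small-∪ (small-≤ (≤-reflexive (length-toList fs)) (small-list (toList fs)))
                                         (small-⋃ (allVecs n) smallClass-small))
                                (small-⋃ triples nearCentre-small)

        live : ∀ {v} → ¬ Deleted v → Live v
        live {v} ¬deleted with ∈-or-fresh v fs | big (class v) in isBig
        ... | inj₁ v∈ | _ = ⊥-elim (¬deleted (inj₁ (inj₁ v∈)))
        ... | inj₂ v∉ | true = v∉ , refl
        ... | inj₂ v∉ | false = ⊥-elim (¬deleted (inj₁ (inj₂ (_ , ∈-allVecs (class v) , v∉ , refl , isBig))))

        -- Whatever equals or deviates from a vertex of the chosen path is deleted. Hence a
        -- surviving path with the same classes is disjoint from it and follows the default towards
        -- it, which is the configuration of `twoPathsExcluded`.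
        no-path : ∀ {c d e u a b} → ¬ Deleted u → ¬ Deleted a → ¬ Deleted b → ¬ Path c d e u a b
        no-path {c} {d} {e} {u} {a} {b} ¬u ¬a ¬b p@record { class-u = refl ; class-a = refl ; class-b = refl } = absurd
          where
          module p = Path p
          t∈ : (class u , class a , class b) ∈ triples
          t∈ = ∈-cartesianProduct⁺ (live-∈ p.live-u) (∈-cartesianProduct⁺ (live-∈ p.live-a) (live-∈ p.live-b))

          far : ∀ {v q} → ¬ Deleted v → q ∈ centres (class u , class a , class b) → ¬ Near q v
          far ¬v q∈ near = ¬v (inj₂ (_ , t∈ , _ , q∈ , near))

          absurd : ⊥
          absurd with em {SomePath (class u , class a , class b)} | (λ {v} {q} → far {v} {q})
          ... | no ¬p | _ = ¬p (u , a , b , p)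
          ... | yes (u₁ , a₁ , b₁ , p₁) | far′ = excluded-sound G {vs = b ∷ a ∷ u ∷ b₁ ∷ a₁ ∷ u₁ ∷ fs}
              ( p.b≢a ∷ p.b≢u ∷ ≢centre ¬b b₁∈ ∷ ≢centre ¬b a₁∈ ∷ ≢centre ¬b u₁∈ ∷ proj₁ p.live-b
              , p.a≢u ∷ ≢centre ¬a b₁∈ ∷ ≢centre ¬a a₁∈ ∷ ≢centre ¬a u₁∈ ∷ proj₁ p.live-a
              , ≢centre ¬u b₁∈ ∷ ≢centre ¬u a₁∈ ∷ ≢centre ¬u u₁∈ ∷ proj₁ p.live-u
              , p₁.b≢a ∷ p₁.b≢u ∷ proj₁ p₁.live-b
              , p₁.a≢u ∷ proj₁ p₁.live-a
              , proj₁ p₁.live-u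
              , distinct)
              avoids
              (trans (cong (excluded Ps) (cong₂ _,_
                  (cong₂ _∷_ (¬H⇒default p.¬H-ba) (cong₂ _∷_ p.H-bu (cong₂ _∷_ (default ¬b b₁∈ p.live-b p₁.live-b p₁.class-b)
                    (cong₂ _∷_ (default ¬b a₁∈ p.live-b p₁.live-a p₁.class-a)
                      (cong (_∷ class b) (default ¬b u₁∈ p.live-b p₁.live-u p₁.class-u))))))
                (cong₂ _,_
                  (cong₂ _∷_ p.H-au (cong₂ _∷_ (default ¬a b₁∈ p.live-a p₁.live-b p₁.class-b)
                    (cong₂ _∷_ (default ¬a a₁∈ p.live-a p₁.live-a p₁.class-a)
                      (cong (_∷ class a) (default ¬a u₁∈ p.live-a p₁.live-u p₁.class-u)))))
                (cong₂ _,_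
                  (cong₂ _∷_ (default ¬u b₁∈ p.live-u p₁.live-b p₁.class-b)
                    (cong₂ _∷_ (default ¬u a₁∈ p.live-u p₁.live-a p₁.class-a)
                      (cong (_∷ class u) (default ¬u u₁∈ p.live-u p₁.live-u p₁.class-u))))
                (cong₂ _,_
                  (cong₂ _∷_ (trans (¬H⇒default p₁.¬H-ba) (cong₂ β p₁.class-b p₁.class-a))
                    (cong₂ _∷_ (trans p₁.H-bu (cong not (cong₂ β p₁.class-b p₁.class-u))) p₁.class-b))
                (cong₂ _,_
                  (cong₂ _∷_ (trans p₁.H-au (cong not (cong₂ β p₁.class-a p₁.class-u))) p₁.class-a)
                (cong (_, matrix G fs) p₁.class-u)))))))
              (paths-ok (live-∈ p.live-u) (live-∈ p.live-a) (live-∈ p.live-b)))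
            where
            module p₁ = Path p₁
            cs = u₁ ∷ a₁ ∷ b₁ ∷ []
            u₁∈ : u₁ ∈ cs
            u₁∈ = here refl
            a₁∈ : a₁ ∈ cs
            a₁∈ = there (here refl)
            b₁∈ : b₁ ∈ cs
            b₁∈ = there (there (here refl))

            ≢centre : ∀ {v q} → ¬ Deleted v → q ∈ cs → v ≢ q
            ≢centre ¬v q∈ = far′ ¬v q∈ ∘ inj₁

            default : ∀ {v q} {k : Class} → ¬ Deleted v → q ∈ cs → Live v → Live q → class q ≡ k → adj v q ≡ β (class v) k
            default ¬v q∈ vl ql refl = ¬near⇒default ql vl (far′ ¬v q∈)

        H-trans : ∀ {u v w} → ¬ Deleted u → ¬ Deleted v → ¬ Deleted w → H u v → H v w → u ≢ w → H u w
        H-trans {u} {v} {w} ¬u ¬v ¬w h h′ u≢w with u Fin.≟ v | w Fin.≟ v | em {H u w}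
        ... | yes refl | _ | _ = h′
        ... | no _ | yes refl | _ = h
        -- What remains is a failure of transitivity, that is, a path with middle vertex `v`.
        ... | no _ | no _ | yes h″ = h″
        ... | no u≢v | no w≢v | no ¬h = ⊥-elim (no-path ¬v ¬w ¬u record
          { live-u = live ¬v ; live-a = live ¬w ; live-b = live ¬u
          ; class-u = refl ; class-a = refl ; class-b = refl
          ; a≢u = w≢v ; b≢u = u≢v ; b≢a = u≢w
          ; H-au = H-sym h′ ; H-bu = h ; ¬H-ba = ¬h })

      opaque
        unfolding scheme

        anchored-matrix : Rep (scheme m) G (λ _ → ⊥)
        anchored-matrix = undelete-small (deletions m) deleted-small (cluster (finite-Vec n) β class β-sym H-trans)

    anchored : ∀ {Ps} → All (Avoids G) Ps → ∀ {n} {F : Tri n} → Checked Ps F → Contains G F →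
               Rep (Anchor.scheme Ps F m) G (λ _ → ⊥)
    anchored avoids (by-check passed) (fs , distinct , refl) = anchored-matrix avoids fs distinct passed

-- Bipartite graphs

true≢false : true ≢ false
true≢false ()

-- Both sides are the size of the union.
count-difference : ∀ {n} (f g : Fin n → Bool) →
  countFin (λ i → f i ∧ not (g i)) + countFin g ≡ countFin (λ i → g i ∧ not (f i)) + countFin f
count-difference {zero} f g = refl
count-difference {suc n} f g with f zero | g zero | count-difference (f ∘ suc) (g ∘ suc)
... | true  | true  | eq = trans (+-suc _ _) (trans (cong suc eq) (sym (+-suc _ _)))
... | true  | false | eq = trans (cong suc eq) (sym (+-suc _ _))
... | false | true  | eq = trans (+-suc _ _) (cong suc eq)
... | false | false | eq = eq

count-positive : ∀ {n} (f : Fin n → Bool) i → f i ≡ true → 1 ≤ countFin f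
count-positive f zero eq rewrite eq = s≤s z≤n
count-positive f (suc i) eq = ≤-trans (count-positive (f ∘ suc) i eq) (ℕₚ.m≤n+m _ _)

count-one : ∀ {n} (f : Fin n → Bool) → 1 ≤ countFin f → ∃ λ i → f i ≡ true
count-one {suc n} f 1≤ with f zero in eq
... | true = zero , eq
... | false with count-one (f ∘ suc) 1≤
... | i , eqᵢ = suc i , eqᵢ

count-two : ∀ {n} (f : Fin n → Bool) → 2 ≤ countFin f → ∃₂ λ i j → i ≢ j × f i ≡ true × f j ≡ true
count-two {suc n} f 2≤ with f zero in eq
count-two {suc n} f (s≤s 1≤) | true with count-one (f ∘ suc) 1≤
... | i , eqᵢ = zero , suc i , (λ ()) , eq , eqᵢ
count-two {suc n} f 2≤ | false with count-two (f ∘ suc) 2≤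
... | i , j , i≢j , eqᵢ , eqⱼ = suc i , suc j , (λ { refl → i≢j refl }) , eqᵢ , eqⱼ

maxFin : ∀ {n} → (Fin n → ℕ) → ℕ
maxFin {zero}  f = 0
maxFin {suc n} f = f zero ℕ.⊔ maxFin (f ∘ suc)

≤-maxFin : ∀ {n} (f : Fin n → ℕ) i → f i ≤ maxFin f
≤-maxFin f zero = ℕₚ.m≤m⊔n _ _
≤-maxFin f (suc i) = ≤-trans (≤-maxFin (f ∘ suc) i) (ℕₚ.m≤n⊔m _ _)

maxFin-attained : ∀ {n} (f : Fin n → ℕ) → maxFin f ≡ 0 ⊎ ∃ λ i → f i ≡ maxFin f
maxFin-attained {zero} f = inj₁ refl
maxFin-attained {suc n} f with ℕₚ.⊔-sel (f zero) (maxFin (f ∘ suc)) | maxFin-attained (f ∘ suc)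
... | inj₁ eq | _ = inj₂ (zero , sym eq)
... | inj₂ eq | inj₁ eq₀ = inj₁ (trans eq eq₀)
... | inj₂ eq | inj₂ (i , eqᵢ) = inj₂ (suc i , trans eqᵢ (sym eq))

¬true⇒false : ∀ {b} → b ≢ true → b ≡ false
¬true⇒false = ¬-not

∨-elim : ∀ x {y} → x ∨ y ≡ true → x ≡ true ⊎ y ≡ true
∨-elim true  _  = inj₁ refl
∨-elim false eq = inj₂ eq

module Forbidden (G : Graph) (no-diamond : Avoids G (4 , diamond)) (no-P₂+P₃ : Avoids G (5 , P₂+P₃)) where
  open Graph G using (adj; adj-sym; adj-irrefl)

  adj⇒≢ : ∀ {u v} → adj u v ≡ true → u ≢ v
  adj⇒≢ uv refl = true≢false (trans (sym uv) (adj-irrefl _))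

  separated : ∀ {u v} w → adj u w ≡ true → adj v w ≡ false → u ≢ v
  separated _ uw vw refl = true≢false (trans (sym uw) vw)

  flip : ∀ {u v b} → adj u v ≡ b → adj v u ≡ b
  flip {u} {v} eq = trans (adj-sym v u) eq

  ¬P₂+P₃ : ∀ {a b c d e} → adj a b ≡ true → adj c d ≡ true → adj d e ≡ true → adj c e ≡ false → c ≢ e →
    adj a c ≡ false → adj a d ≡ false → adj a e ≡ false → adj b c ≡ false → adj b d ≡ false → adj b e ≡ false → ⊥
  ¬P₂+P₃ {a} {b} {c} {d} {e} ab cd de ce c≢e ac ad ae bc bd be =
    no-P₂+P₃ (b ∷ a ∷ e ∷ c ∷ d ∷ [])
      ( (adj⇒≢ (flip ab) ∷ separated a (flip ab) (flip ae) ∷ separated a (flip ab) (flip ac)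
          ∷ separated a (flip ab) (flip ad) ∷ [])
      , (separated b ab (flip be) ∷ separated b ab (flip bc) ∷ separated b ab (flip bd) ∷ [])
      , ((c≢e ∘ sym) ∷ adj⇒≢ (flip de) ∷ [])
      , (adj⇒≢ cd ∷ [])
      , [] , _)
      (cong₂ _,_ (cong₂ _∷_ (flip ab) (cong₂ _∷_ be (cong₂ _∷_ bc (cong (_∷ []) bd))))
      (cong₂ _,_ (cong₂ _∷_ ae (cong₂ _∷_ ac (cong (_∷ []) ad)))
      (cong₂ _,_ (cong₂ _∷_ (flip ce) (cong (_∷ []) (flip de)))
      (cong₂ _,_ (cong (_∷ []) cd) refl))))

  ¬diamond : ∀ {a b c d} → adj a b ≡ true → adj a c ≡ true → adj b c ≡ true → adj a d ≡ true → adj b d ≡ true →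
    adj c d ≡ false → c ≢ d → ⊥
  ¬diamond {a} {b} {c} {d} ab ac bc ad bd cd c≢d =
    no-diamond (d ∷ c ∷ b ∷ a ∷ [])
      ( ((c≢d ∘ sym) ∷ adj⇒≢ (flip bd) ∷ adj⇒≢ (flip ad) ∷ [])
      , (adj⇒≢ (flip bc) ∷ adj⇒≢ (flip ac) ∷ [])
      , (adj⇒≢ (flip ab) ∷ [])
      , [] , _)
      (cong₂ _,_ (cong₂ _∷_ (flip cd) (cong₂ _∷_ (flip bd) (cong (_∷ []) (flip ad))))
      (cong₂ _,_ (cong₂ _∷_ (flip bc) (cong (_∷ []) (flip ac)))
      (cong₂ _,_ (cong (_∷ []) (flip ab)) refl)))

-- Within a level, the edges form a matching (mode 1F) or the complement of a matching (mode 2F),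
-- possibly with isolated vertices.
ψ : Fin 3 → Bool → Rel → Bool
ψ _  _ after  = true
ψ _  _ before = false
ψ 1F _ same   = true
ψ _  _ same   = false
ψ 2F z apart  = z
ψ _  _ apart  = false

module Bipartite (em : ExcludedMiddle 0ℓ) (G : Graph) (no-diamond : Avoids G (4 , diamond)) (no-P₂+P₃ : Avoids G (5 , P₂+P₃))
  (X Y : Vertex G → Bool) (disjoint : ∀ {v} → X v ≡ true → Y v ≡ false)
  (X-independent : ∀ {u v} → X u ≡ true → X v ≡ true → Graph.adj G u v ≡ false)
  (Y-independent : ∀ {u v} → Y u ≡ true → Y v ≡ true → Graph.adj G u v ≡ false)
  where
  open Graph G using (adj; adj-sym; adj-irrefl)
  open Forbidden G no-diamond no-P₂+P₃

  private
    V = Vertex G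

    -- Otherwise the edge from `x` to `y` and the path from `y₁` through `x′` to `y₂` induce
    -- `P₂+P₃`.
    swap : ∀ {x x′ y y₁ y₂} → X x ≡ true → X x′ ≡ true → Y y ≡ true → Y y₁ ≡ true → Y y₂ ≡ true →
      adj x y ≡ true → adj x′ y ≡ false → adj x′ y₁ ≡ true → adj x′ y₂ ≡ true → adj x y₁ ≡ false → adj x y₂ ≡ false →
      y₁ ≡ y₂
    swap {y₁ = y₁} {y₂} Xx Xx′ Yy Yy₁ Yy₂ xy x′y x′y₁ x′y₂ xy₁ xy₂ with y₁ Fin.≟ y₂
    ... | yes eq = eq
    ... | no y₁≢y₂ = ⊥-elim (¬P₂+P₃ xy (flip x′y₁) x′y₂ (Y-independent Yy₁ Yy₂) y₁≢y₂
            xy₁ (X-independent Xx Xx′) xy₂ (Y-independent Yy Yy₁) (flip x′y) (Y-independent Yy Yy₂))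

    nb : V → V → Bool
    nb x y = Y y ∧ adj x y

    deg : V → ℕ
    deg x = countFin (nb x)

    nb-intro : ∀ {x x′ y} → Y y ≡ true → adj x y ≡ true → adj x′ y ≡ false → nb x y ∧ not (nb x′ y) ≡ true
    nb-intro Yy xy x′y rewrite Yy | xy | x′y = refl

    nb-elim : ∀ {x x′ y} → nb x y ∧ not (nb x′ y) ≡ true → Y y ≡ true × adj x y ≡ true × adj x′ y ≡ false
    nb-elim {x} {x′} {y} eq with Y y | adj x y | adj x′ y
    ... | true | true | false = refl , refl , refl

    -- The neighbour `y` lost by `x′` and its surplus `k` in degree must both be made up by
    -- neighbours that `x` lacks.
    balance : ∀ {x x′ y} k → k + deg x ≤ deg x′ → Y y ≡ true → adj x y ≡ true → adj x′ y ≡ false →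
      suc k ≤ countFin (λ y → nb x′ y ∧ not (nb x y))
    balance {x} {x′} {y} k deg≤ Yy xy x′y = ℕₚ.+-cancelʳ-≤ (deg x) _ _ (begin
      suc (k + deg x)                                        ≤⟨ s≤s deg≤ ⟩
      1 + deg x′                                             ≤⟨ ℕₚ.+-monoˡ-≤ (deg x′) (count-positive _ y (nb-intro {x} {x′} Yy xy x′y)) ⟩
      countFin (λ y → nb x y ∧ not (nb x′ y)) + deg x′        ≡⟨ count-difference (nb x) (nb x′) ⟩
      countFin (λ y → nb x′ y ∧ not (nb x y)) + deg x         ∎)
      where open ℕₚ.≤-Reasoning

    -- A neighbour `y` missed by the vertex of larger degree would have to be made up by two others,
    -- against `swap`. So neighbourhoods of different sizes are nested.
    deg-< : ∀ {x x′ y} → deg x < deg x′ → X x ≡ true → X x′ ≡ true → Y y ≡ true → adj x y ≡ true → adj x′ y ≡ false → ⊥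
    deg-< {x} {x′} deg< Xx Xx′ Yy xy x′y with count-two _ (balance {x} {x′} 1 deg< Yy xy x′y)
    ... | y₁ , y₂ , y₁≢y₂ , eq₁ , eq₂ with nb-elim {x′} {x} eq₁ | nb-elim {x′} {x} eq₂
    ... | Yy₁ , x′y₁ , xy₁ | Yy₂ , x′y₂ , xy₂ = y₁≢y₂ (swap Xx Xx′ Yy Yy₁ Yy₂ xy x′y x′y₁ x′y₂ xy₁ xy₂)

    exchange : ∀ {x x′ y} → deg x ≡ deg x′ → Y y ≡ true → adj x y ≡ true → adj x′ y ≡ false →
      ∃ λ y′ → Y y′ ≡ true × adj x′ y′ ≡ true × adj x y′ ≡ false
    exchange {x} {x′} deg≡ Yy xy x′y with count-one _ (balance {x} {x′} 0 (≤-reflexive deg≡) Yy xy x′y)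
    ... | y′ , eq = y′ , nb-elim {x′} {x} eq

    unique : ∀ {x x′ y₁ y₂} → deg x ≡ deg x′ → X x ≡ true → X x′ ≡ true → Y y₁ ≡ true → Y y₂ ≡ true →
      adj x y₁ ≡ true → adj x y₂ ≡ true → adj x′ y₁ ≡ false → adj x′ y₂ ≡ false → y₁ ≡ y₂
    unique deg≡ Xx Xx′ Yy₁ Yy₂ xy₁ xy₂ x′y₁ x′y₂ with exchange deg≡ Yy₁ xy₁ x′y₁
    ... | y′ , Yy′ , x′y′ , xy′ = swap Xx′ Xx Yy′ Yy₁ Yy₂ x′y′ xy′ xy₁ xy₂ x′y₁ x′y₂

    height : V → V → ℕ
    height y x = if X x ∧ not (adj x y) then suc (deg x) else 0

    -- Determined by the largest degree among the nonneighbours of `y`: vertices of larger degree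
    -- are adjacent to `y`, and nestedness keeps those of smaller degree away from it. The successor
    -- in `height` leaves 0 for a `y` adjacent to all of `X`.
    levelY : V → ℕ
    levelY y = maxFin (height y)

    levelY-≥ : ∀ {x y} → X x ≡ true → adj x y ≡ false → suc (deg x) ≤ levelY y
    levelY-≥ {x} {y} Xx xy = subst (_≤ levelY y) eq (≤-maxFin (height y) x)
      where
      eq : height y x ≡ suc (deg x)
      eq rewrite Xx | xy = refl

    levelY-attained : ∀ {d y} → suc d ≤ levelY y → ∃ λ x → X x ≡ true × adj x y ≡ false × suc (deg x) ≡ levelY y
    levelY-attained {d} {y} d<l with maxFin-attained (height y)
    ... | inj₁ eq = ⊥-elim (ℕₚ.n≮0 (subst (suc d ≤_) eq d<l))
    ... | inj₂ (x , eq) with X x in Xx | adj x y in xy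
    ... | true | false = x , Xx , xy , eq
    ... | true | true = ⊥-elim (ℕₚ.n≮0 (subst (suc d ≤_) (sym eq) d<l))
    ... | false | _ = ⊥-elim (ℕₚ.n≮0 (subst (suc d ≤_) (sym eq) d<l))

    above : ∀ {x y} → X x ≡ true → levelY y < suc (deg x) → adj x y ≡ true
    above {x} {y} Xx l< with adj x y in xy
    ... | true = refl
    ... | false = ⊥-elim (ℕₚ.<⇒≱ l< (levelY-≥ Xx xy))

    below : ∀ {x y} → X x ≡ true → Y y ≡ true → suc (deg x) < levelY y → adj x y ≡ false
    below {x} {y} Xx Yy <l with adj x y in xy
    ... | false = refl
    ... | true with levelY-attained (ℕₚ.<⇒≤ <l)
    ... | x′ , Xx′ , x′y , eq = ⊥-elim (deg-< (ℕₚ.≤-pred (subst (suc (deg x) <_) (sym eq) <l)) Xx Xx′ Yy xy x′y)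

    -- Witnesses that the neighbourhoods of degree `d` do not share all but one element: `x₁` and
    -- `x₂` differ at `p` and have `y₀` in common, yet by its level `y₀` is missed by a vertex of
    -- degree `d`. Then all these neighbourhoods arise from the union of those of `x₁` and `x₂` by
    -- removing one element.
    record Co (d : ℕ) : Set where
      field
        x₁ x₂ y₀ p : V
        Xx₁ : X x₁ ≡ true
        Xx₂ : X x₂ ≡ true
        Yy₀ : Y y₀ ≡ true
        Yp  : Y p ≡ true
        deg-x₁ : deg x₁ ≡ d
        deg-x₂ : deg x₂ ≡ d
        level-y₀ : levelY y₀ ≡ suc d
        x₁y₀ : adj x₁ y₀ ≡ true
        x₂y₀ : adj x₂ y₀ ≡ true
        x₁p  : adj x₁ p ≡ true
        x₂p  : adj x₂ p ≡ false

    coSet : ∀ {d} → Dec (Co d) → V → Bool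
    coSet (no _)   y = false
    coSet (yes co) y = adj (Co.x₁ co) y ∨ adj (Co.x₂ co) y

    ∨-false : ∀ {x y} → x ∨ y ≡ false → x ≡ false × y ≡ false
    ∨-false {false} eq = refl , eq

    module _ {d} (co : Co d) where
      open Co co

      private
        Z : V → Bool
        Z y = adj x₁ y ∨ adj x₂ y

        deg₁₂ : deg x₁ ≡ deg x₂
        deg₁₂ = trans deg-x₁ (sym deg-x₂)

      -- Let `p` and `q` be the elements exchanged between `x₁` and `x₂`. A neighbour outside the
      -- union uses up the one exchange allowed to `x`, so `x` misses both. A vertex `x₀` that
      -- misses `y₀` has used up its own exchange and keeps both. Then `x₀` and `x` differ by two
      -- elements.
      Z-supset : ∀ {x y} → X x ≡ true → deg x ≡ d → Y y ≡ true → adj x y ≡ true → Z y ≡ true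
      Z-supset {x} {y} Xx deg-x Yy xy with Z y in Zy
      ... | true = refl
      ... | false with ∨-false {adj x₁ y} Zy | exchange deg₁₂ Yp x₁p x₂p | levelY-attained (≤-reflexive (sym level-y₀))
      ... | x₁y , x₂y | q , Yq , x₂q , x₁q | x₀ , Xx₀ , x₀y₀ , deg-x₀′ =
        ⊥-elim (separated x₁ (flip x₁p) (flip x₁q) (unique (trans deg-x₀ (sym deg-x)) Xx₀ Xx Yp Yq x₀p x₀q xp xq))
        where
        deg-x₀ : deg x₀ ≡ d
        deg-x₀ = ℕₚ.suc-injective (trans deg-x₀′ level-y₀)

        xq : adj x q ≡ false
        xq = ¬true⇒false λ xq → separated x₂ (flip x₂q) (flip x₂y)
          (unique (trans deg-x (sym deg-x₁)) Xx Xx₁ Yq Yy xq xy x₁q x₁y)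

        xp : adj x p ≡ false
        xp = ¬true⇒false λ xp → separated x₁ (flip x₁p) (flip x₁y)
          (unique (trans deg-x (sym deg-x₂)) Xx Xx₂ Yp Yy xp xy x₂p x₂y)

        x₀p : adj x₀ p ≡ true
        x₀p with adj x₀ p in eq
        ... | true = refl
        ... | false = ⊥-elim (separated x₂ (flip x₂y₀) (flip x₂p)
                (unique (trans deg-x₁ (sym deg-x₀)) Xx₁ Xx₀ Yy₀ Yp x₁y₀ x₁p x₀y₀ eq))

        x₀q : adj x₀ q ≡ true
        x₀q with adj x₀ q in eq
        ... | true = refl
        ... | false = ⊥-elim (separated x₁ (flip x₁y₀) (flip x₁q)
                (unique (trans deg-x₂ (sym deg-x₀)) Xx₂ Xx₀ Yy₀ Yq x₂y₀ x₂q x₀y₀ eq))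

      Z-missed : ∀ {x} → X x ≡ true → deg x ≡ d → ∃ λ s → Y s ≡ true × Z s ≡ true × adj x s ≡ false
      Z-missed {x} Xx deg-x with exchange deg₁₂ Yp x₁p x₂p
      ... | q , Yq , x₂q , x₁q with adj x q in xq
      ... | false = q , Yq , trans (cong (adj x₁ q ∨_) x₂q) (∨-zeroʳ _) , xq
      ... | true with exchange (trans deg-x (sym deg-x₁)) Yq xq x₁q
      ... | r , Yr , x₁r , xr = r , Yr , cong (_∨ adj x₂ r) x₁r , xr

      -- In exchange for `s`, the vertex `x` has a neighbour `r` that `x₁` misses. It lies in the
      -- union, so `x₂` has both `r` and `t` beyond `x₁`, and these differ because `x` misses `t`.
      crossed : ∀ {x s t} → X x ≡ true → deg x ≡ d → Y s ≡ true → Y t ≡ true → adj x₁ s ≡ true → adj x₁ t ≡ false → adj x₂ t ≡ true →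
        adj x s ≡ false → adj x t ≡ false → ⊥
      crossed {x} {s} {t} Xx deg-x Ys Yt x₁s x₁t x₂t xs xt with exchange (trans deg-x₁ (sym deg-x)) Ys x₁s xs
      ... | r , Yr , xr , x₁r with ∨-elim (adj x₁ r) (Z-supset Xx deg-x Yr xr)
      ... | inj₁ x₁r′ = true≢false (trans (sym x₁r′) x₁r)
      ... | inj₂ x₂r = separated x (flip xr) (flip xt)
              (unique (trans deg-x₂ (sym deg-x₁)) Xx₂ Xx₁ Yr Yt x₂r x₂t x₁r x₁t)

      Z-missed-unique : ∀ {x s t} → X x ≡ true → deg x ≡ d → Y s ≡ true → Y t ≡ true → Z s ≡ true → Z t ≡ true →
        adj x s ≡ false → adj x t ≡ false → s ≡ t
      Z-missed-unique {x} {s} {t} Xx deg-x Ys Yt Zs Zt xs xt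
        with adj x₁ s in x₁s | adj x₁ t in x₁t
      ... | true | true = unique (trans deg-x₁ (sym deg-x)) Xx₁ Xx Ys Yt x₁s x₁t xs xt
      ... | false | false = unique (trans deg-x₂ (sym deg-x)) Xx₂ Xx Ys Yt Zs Zt xs xt
      ... | true | false = ⊥-elim (crossed Xx deg-x Ys Yt x₁s x₁t Zt xs xt)
      ... | false | true = ⊥-elim (crossed Xx deg-x Yt Ys x₁t x₁s Zs xt xs)

    co? : ∀ d → Dec (Co d)
    co? d = em

  -- The union is chosen per degree, so all vertices of a level refer to the same one. `pred` undoes
  -- the successor in `height`; level 0 contains no vertex of `X`, so its value there does not
  -- matter.
  inZ : V → Bool
  inZ y = coSet (co? (pred (levelY y))) y

  private
    record Profile (x : V) : Set where
      field
        mode  : Fin 3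
        block : ℕ
        on-block  : ∀ {y} → Y y ≡ true → levelY y ≡ suc (deg x) → block ≡ toℕ y → adj x y ≡ ψ mode (inZ y) same
        off-block : ∀ {y} → Y y ≡ true → levelY y ≡ suc (deg x) → block ≢ toℕ y → adj x y ≡ ψ mode (inZ y) apart

    inZ-level : ∀ {x y} → levelY y ≡ suc (deg x) → inZ y ≡ coSet (co? (deg x)) y
    inZ-level {x} {y} eq = cong (λ l → coSet (co? (pred l)) y) eq

    profile : ∀ x → X x ≡ true → Profile x
    profile x Xx with co? (deg x) | (λ {y} → inZ-level {x} {y})
    ... | yes co | inZ≡ with Z-missed co Xx refl
    ... | s , Ys , Zs , xs = record
      { mode = 2F
      ; block = toℕ s
      ; on-block = λ _ _ eq → subst (λ y → adj x y ≡ false) (toℕ-injective eq) xs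
      ; off-block = λ {y} Yy l≡ s≢y → trans (off Yy s≢y) (sym (inZ≡ l≡)) }
      where
      off : ∀ {y} → Y y ≡ true → toℕ s ≢ toℕ y → adj x y ≡ coSet (yes co) y
      off {y} Yy s≢y with adj x y in xy | coSet (yes co) y in Zy
      ... | true  | true  = refl
      ... | false | false = refl
      ... | true  | false = ⊥-elim (true≢false (trans (sym (Z-supset co Xx refl Yy xy)) Zy))
      ... | false | true  = ⊥-elim (s≢y (cong toℕ (Z-missed-unique co Xx refl Ys Yy Zs Zy xs xy)))
    profile x Xx | no ¬co | _ with em {∃ λ y → Y y ≡ true × levelY y ≡ suc (deg x) × adj x y ≡ true}
    ... | no ¬y = record
      { mode = 0F
      -- An arbitrary value: mode `0F` gives nonadjacency for `same` and `apart` alike.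
      ; block = 0
      ; on-block = λ Yy l≡ _ → ¬true⇒false λ xy → ¬y (_ , Yy , l≡ , xy)
      ; off-block = λ Yy l≡ _ → ¬true⇒false λ xy → ¬y (_ , Yy , l≡ , xy) }
    ... | yes (y , Yy , l≡ , xy) = record
      { mode = 1F
      ; block = toℕ y
      ; on-block = λ _ _ eq → subst (λ y → adj x y ≡ true) (toℕ-injective eq) xy
      ; off-block = λ Yy′ l≡′ y≢y′ → ¬true⇒false λ xy′ → y≢y′ (cong toℕ (only Yy′ l≡′ xy′)) }
      where
      -- Some `x′` of the same degree misses `y`. If it misses `y′` too, only one exchange is
      -- available; if not, `x` and `x′` witness `Co`.
      only : ∀ {y′} → Y y′ ≡ true → levelY y′ ≡ suc (deg x) → adj x y′ ≡ true → y ≡ y′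
      only {y′} Yy′ l≡′ xy′ with levelY-attained (≤-reflexive (sym l≡))
      ... | x′ , Xx′ , x′y , eq with adj x′ y′ in x′y′
      ... | false = unique deg≡ Xx Xx′ Yy Yy′ xy xy′ x′y x′y′
        where
        deg≡ : deg x ≡ deg x′
        deg≡ = sym (ℕₚ.suc-injective (trans eq l≡))
      ... | true = ⊥-elim (¬co record
              { x₁ = x ; x₂ = x′ ; y₀ = y′ ; p = y
              ; Xx₁ = Xx ; Xx₂ = Xx′ ; Yy₀ = Yy′ ; Yp = Yy
              ; deg-x₁ = refl ; deg-x₂ = ℕₚ.suc-injective (trans eq l≡) ; level-y₀ = l≡′
              ; x₁y₀ = xy′ ; x₂y₀ = x′y′ ; x₁p = xy ; x₂p = x′y })

  mode : V → Fin 3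
  mode v with X v ≟ᵇ true
  ... | yes Xv = Profile.mode (profile v Xv)
  ... | no _   = 0F

  addr : V → ℕ × ℕ
  addr v with X v ≟ᵇ true
  ... | yes Xv = suc (deg v) , Profile.block (profile v Xv)
  ... | no _   = levelY v , toℕ v

  adj-ψ : ∀ {x y} → X x ≡ true → Y y ≡ true → adj x y ≡ ψ (mode x) (inZ y) (rel (addr x) (addr y))
  adj-ψ {x} {y} Xx Yy with X x ≟ᵇ true | X y ≟ᵇ true
  ... | no ¬Xx | _ = ⊥-elim (¬Xx Xx)
  ... | yes _ | yes Xy = ⊥-elim (true≢false (trans (sym Yy) (disjoint Xy)))
  ... | yes Xx | no _ with profile x Xx | <-cmp (suc (deg x)) (levelY y)
  ... | π | tri< l< _ _ = trans (below Xx Yy l<) (sym (trans (cong (ψ _ _) (rel-before {_ , Profile.block π} {_ , toℕ y} l<)) (ψ-before (Profile.mode π) {inZ y})))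
    where
    ψ-before : ∀ m {z} → ψ m z before ≡ false
    ψ-before 0F = refl
    ψ-before 1F = refl
    ψ-before 2F = refl
  ... | π | tri> _ _ l> = trans (above Xx l>) (sym (trans (cong (ψ _ _) (rel-after {_ , Profile.block π} {_ , toℕ y} l>)) (ψ-after (Profile.mode π) {inZ y})))
    where
    ψ-after : ∀ m {z} → ψ m z after ≡ true
    ψ-after 0F = refl
    ψ-after 1F = refl
    ψ-after 2F = refl
  ... | π | tri≈ _ l≡ _ with Profile.block π ℕ.≟ toℕ y
  ... | yes on = trans (Profile.on-block π Yy (sym l≡) on) (cong (ψ _ _) (sym (rel-same {_ , _} l≡ on)))
  ... | no off = trans (Profile.off-block π Yy (sym l≡) off) (cong (ψ _ _) (sym (rel-apart {_ , _} l≡ off)))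

  adj-ψ-converse : ∀ {x y} → X x ≡ true → Y y ≡ true → adj y x ≡ ψ (mode x) (inZ y) (converse (rel (addr y) (addr x)))
  adj-ψ-converse {x} {y} Xx Yy = trans (adj-sym y x) (trans (adj-ψ Xx Yy) (cong (ψ _ _) (rel-converse (addr y) (addr x))))

bipartiteScheme : Scheme
bipartiteScheme = record
  { Type = Fin 3 × Bool × Bool
  ; finite = finite-× (finite-Fin 3) (finite-× finite-Bool finite-Bool)
  ; φ = λ { (m , _ , true)  (_ , z , false) r → ψ m z r
          ; (_ , z , false) (m , _ , true)  r → ψ m z (converse r)
          ; _ _ _ → false } }

-- Two-colouring without triangles and `C₅`

module TwoColour (em : ExcludedMiddle 0ℓ) (G : Graph)
  (no-diamond : Avoids G (4 , diamond)) (no-P₂+P₃ : Avoids G (5 , P₂+P₃)) (no-C₅ : Avoids G (5 , C₅))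
  (D : Vertex G → Set)
  (no-triangle : ∀ {a b c} → ¬ D a → ¬ D b → ¬ D c →
                 Graph.adj G a b ≡ true → Graph.adj G b c ≡ true → Graph.adj G a c ≡ true → ⊥)
  where
  open Graph G using (adj; adj-sym; adj-irrefl)
  open Forbidden G no-diamond no-P₂+P₃

  private
    V = Vertex G

    Live : V → Set
    Live v = ¬ D v

    chord : ∀ {a b c d e} → Live a → Live b → Live c → Live d → Live e →
      adj a b ≡ true → adj b c ≡ true → adj c d ≡ true → adj d e ≡ true → adj e a ≡ true → adj a c ≡ false × a ≢ c
    chord la lb lc ld le ab bc cd de ea =
      ¬true⇒false (no-triangle la lb lc ab bc) , λ { refl → no-triangle lc ld le cd de (flip ea) }

    -- In the absence of triangles a closed walk of length five has no repetition and no chord, so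
    -- it is an induced cycle.
    ¬walk : ∀ {a b c d e} → Live a → Live b → Live c → Live d → Live e →
      adj a b ≡ true → adj b c ≡ true → adj c d ≡ true → adj d e ≡ true → adj e a ≡ true → ⊥
    ¬walk {a} {b} {c} {d} {e} la lb lc ld le ab bc cd de ea
      with chord la lb lc ld le ab bc cd de ea | chord lb lc ld le la bc cd de ea ab
         | chord lc ld le la lb cd de ea ab bc | chord ld le la lb lc de ea ab bc cd
         | chord le la lb lc ld ea ab bc cd de
    ... | ac , a≢c | bd , b≢d | ce , c≢e | da , d≢a | eb , e≢b =
      no-C₅ (e ∷ d ∷ c ∷ b ∷ a ∷ [])
        ( (adj⇒≢ (flip de) ∷ (c≢e ∘ sym) ∷ e≢b ∷ adj⇒≢ ea ∷ [])
        , (adj⇒≢ (flip cd) ∷ (b≢d ∘ sym) ∷ d≢a ∷ [])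
        , (adj⇒≢ (flip bc) ∷ (a≢c ∘ sym) ∷ [])
        , (adj⇒≢ (flip ab) ∷ [])
        , [] , _)
        (cong₂ _,_ (cong₂ _∷_ (flip de) (cong₂ _∷_ (flip ce) (cong₂ _∷_ eb (cong (_∷ []) ea))))
        (cong₂ _,_ (cong₂ _∷_ (flip cd) (cong₂ _∷_ (flip bd) (cong (_∷ []) da)))
        (cong₂ _,_ (cong₂ _∷_ (flip bc) (cong (_∷ []) (flip ac)))
        (cong₂ _,_ (cong (_∷ []) (flip ab)) refl))))

    -- Vertices at distance two from v are coloured true, those at distance two from u false. An
    -- edge outside is a component of the antineighbourhood of the edge uv.
    module _ {u v} (lu : Live u) (lv : Live v) (uv : adj u v ≡ true) where
      Two : V → V → Set
      Two x w = ∃ λ q → Live q × adj x q ≡ true × adj q w ≡ true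

      data Status (w : V) : Set where
        trueˢ  : Two v w → Status w
        falseˢ : Two u w → Status w
        free   : ¬ Two v w → ¬ Two u w → Status w

      status : ∀ w → Status w
      status w with em {Two v w} | em {Two u w}
      ... | yes t | _ = trueˢ t
      ... | no _ | yes f = falseˢ f
      ... | no ¬t | no ¬f = free ¬t ¬f

      two-independent : ∀ {x w w′} → Live x → Live w → Live w′ → adj w w′ ≡ true → Two x w → Two x w′ → ⊥
      two-independent lx lw lw′ ww′ (q , lq , xq , qw) (q′ , lq′ , xq′ , q′w′) =
        ¬walk lw lq lx lq′ lw′ (flip qw) (flip xq) xq′ q′w′ (flip ww′)

      partner-unique : ∀ {w w₁ w₂} → Live w → ¬ Two v w → ¬ Two u w → Live w₁ → Live w₂ →
        adj w w₁ ≡ true → adj w w₂ ≡ true → w₁ ≡ w₂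
      partner-unique {w} {w₁} {w₂} lw ¬t ¬f l₁ l₂ ww₁ ww₂ with w₁ Fin.≟ w₂
      ... | yes eq = eq
      ... | no w₁≢w₂ = ⊥-elim (¬P₂+P₃ uv (flip ww₁) ww₂ (¬true⇒false (no-triangle l₁ lw l₂ (flip ww₁) ww₂)) w₁≢w₂
          (avoid-u l₁ ww₁) (¬true⇒false λ uw → ¬t (u , lu , flip uv , uw)) (avoid-u l₂ ww₂)
          (avoid-v l₁ ww₁) (¬true⇒false λ vw → ¬f (v , lv , uv , vw)) (avoid-v l₂ ww₂))
        where
        avoid-u : ∀ {x} → Live x → adj w x ≡ true → adj u x ≡ false
        avoid-u lx wx = ¬true⇒false λ ux → ¬f (_ , lx , ux , flip wx)
        avoid-v : ∀ {x} → Live x → adj w x ≡ true → adj v x ≡ false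
        avoid-v lx wx = ¬true⇒false λ vx → ¬t (_ , lx , vx , flip wx)

      Partner : V → V → Set
      Partner w w′ = Live w′ × adj w w′ ≡ true

      opposite : V → ∀ {w′} → Status w′ → Bool
      opposite w      (trueˢ _)  = false
      opposite w      (falseˢ _) = true
      -- Both ends of the edge are free, and the order of their indices breaks the tie.
      opposite w {w′} (free _ _) = does (toℕ w ℕ.<? toℕ w′)

      colourBy : ∀ {w} → Status w → Dec (∃ (Partner w)) → Bool
      colourBy (trueˢ _)  _ = true
      colourBy (falseˢ _) _ = false
      colourBy (free _ _) (no _) = true
      colourBy {w} (free _ _) (yes (w′ , _)) = opposite w (status w′)

      colourEdge : V → Bool
      colourEdge w = colourBy (status w) em

      colour-free : ∀ {w w′} → Live w → ¬ Two v w → ¬ Two u w → Live w′ → adj w w′ ≡ true →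
        (s : Status w) (d : Dec (∃ (Partner w))) → colourBy s d ≡ opposite w (status w′)
      colour-free lw ¬t ¬f lw′ ww′ (trueˢ t) _ = ⊥-elim (¬t t)
      colour-free lw ¬t ¬f lw′ ww′ (falseˢ f) _ = ⊥-elim (¬f f)
      colour-free lw ¬t ¬f lw′ ww′ (free _ _) (no ¬p) = ⊥-elim (¬p (_ , lw′ , ww′))
      colour-free lw ¬t ¬f lw′ ww′ (free _ _) (yes (w″ , lw″ , ww″)) with partner-unique lw ¬t ¬f lw′ lw″ ww′ ww″
      ... | refl = refl

      colourEdge-proper : ∀ {a b} → Live a → Live b → adj a b ≡ true → colourEdge a ≢ colourEdge b
      colourEdge-proper {a} {b} la lb ab eq with status a in sa | status b in sb
      ... | trueˢ t  | trueˢ t′  = two-independent lv la lb ab t t′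
      ... | falseˢ f | falseˢ f′ = two-independent lu la lb ab f f′
      ... | trueˢ t  | falseˢ f  = true≢false eq
      ... | falseˢ f | trueˢ t   = true≢false (sym eq)
      ... | free ¬t ¬f | trueˢ _ = true≢false (trans (sym eq)
              (trans (colour-free la ¬t ¬f lb ab (free ¬t ¬f) em) (cong (opposite a) sb)))
      ... | free ¬t ¬f | falseˢ _ = true≢false (trans (sym (trans (colour-free la ¬t ¬f lb ab (free ¬t ¬f) em) (cong (opposite a) sb))) eq)
      ... | trueˢ _ | free ¬t ¬f = true≢false (trans eq
              (trans (colour-free lb ¬t ¬f la (flip ab) (free ¬t ¬f) em) (cong (opposite b) sa)))
      ... | falseˢ _ | free ¬t ¬f = true≢false (trans (sym (trans (colour-free lb ¬t ¬f la (flip ab) (free ¬t ¬f) em) (cong (opposite b) sa))) (sym eq))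
      ... | free ¬t ¬f | free ¬t′ ¬f′ with trans (sym (trans (colour-free la ¬t ¬f lb ab (free ¬t ¬f) em) (cong (opposite a) sb)))
              (trans eq (trans (colour-free lb ¬t′ ¬f′ la (flip ab) (free ¬t′ ¬f′) em) (cong (opposite b) sa)))
      ... | eq′ with <-cmp (toℕ a) (toℕ b)
      ... | tri< a<b _ b≮a = true≢false (trans (sym (dec-true (toℕ a ℕ.<? toℕ b) a<b)) (trans eq′ (dec-false (toℕ b ℕ.<? toℕ a) b≮a)))
      ... | tri> a≮b _ b<a = true≢false (trans (sym (dec-true (toℕ b ℕ.<? toℕ a) b<a)) (trans (sym eq′) (dec-false (toℕ a ℕ.<? toℕ b) a≮b)))
      ... | tri≈ _ a≡b _ = adj⇒≢ ab (toℕ-injective a≡b)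

    colour : V → Bool
    colour with em {∃₂ λ u v → Live u × Live v × adj u v ≡ true}
    ... | yes (u , v , lu , lv , uv) = colourEdge lu lv uv
    ... | no _ = λ _ → true

    colour-proper : ∀ {a b} → Live a → Live b → adj a b ≡ true → colour a ≢ colour b
    colour-proper la lb ab with em {∃₂ λ u v → Live u × Live v × adj u v ≡ true}
    ... | yes (u , v , lu , lv , uv) = colourEdge-proper lu lv uv la lb ab
    ... | no ¬e = ⊥-elim (¬e (_ , _ , la , lb , ab))

    side : Bool → V → Bool
    side s v = does (em {Live v}) ∧ does (colour v ≟ᵇ s)

    side-elim : ∀ {s v} → side s v ≡ true → Live v × colour v ≡ s
    side-elim {s} {v} eq with em {Live v} | colour v ≟ᵇ s
    ... | yes l | yes c = l , c

    side-intro : ∀ {s v} → Live v → colour v ≡ s → side s v ≡ true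
    side-intro {s} {v} l c with em {Live v} | colour v ≟ᵇ s
    ... | yes _ | yes _ = refl
    ... | no ¬l | _ = ⊥-elim (¬l l)
    ... | yes _ | no ¬c = ⊥-elim (¬c c)

    side-independent : ∀ {s a b} → side s a ≡ true → side s b ≡ true → adj a b ≡ false
    side-independent {s} {a} {b} sa sb with side-elim {s} {a} sa | side-elim {s} {b} sb
    ... | la , ca | lb , cb = ¬true⇒false λ ab → colour-proper la lb ab (trans ca (sym cb))

    side-disjoint : ∀ {v} → side true v ≡ true → side false v ≡ false
    side-disjoint {v} tv = ¬true⇒false λ fv → true≢false (trans (sym (proj₂ (side-elim {true} {v} tv))) (proj₂ (side-elim {false} {v} fv)))

    module Bip = Bipartite em G no-diamond no-P₂+P₃ (side true) (side false)
      side-disjoint side-independent side-independent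

  twoColoured : Rep bipartiteScheme G D
  twoColoured = record
    { type = type
    ; addr = Bip.addr
    ; adj-φ = adj-φ }
    where
    type : V → Fin 3 × Bool × Bool
    type v = Bip.mode v , Bip.inZ v , colour v

    byColours : ∀ {u v} s t → ¬ D u → ¬ D v → colour u ≡ s → colour v ≡ t →
      adj u v ≡ Scheme.φ bipartiteScheme (Bip.mode u , Bip.inZ u , s) (Bip.mode v , Bip.inZ v , t) (rel (Bip.addr u) (Bip.addr v))
    byColours true  false lu lv cu cv = Bip.adj-ψ (side-intro lu cu) (side-intro lv cv)
    byColours false true  lu lv cu cv = Bip.adj-ψ-converse (side-intro lv cv) (side-intro lu cu)
    byColours true  true  lu lv cu cv = side-independent (side-intro lu cu) (side-intro lv cv)
    byColours false false lu lv cu cv = side-independent (side-intro lu cu) (side-intro lv cv)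

    adj-φ : ∀ u v → ¬ D u → ¬ D v → u ≢ v →
      adj u v ≡ Scheme.φ bipartiteScheme (type u) (type v) (rel (Bip.addr u) (Bip.addr v))
    adj-φ u v lu lv _ = byColours (colour u) (colour v) lu lv refl refl

-- Two triangles joined by two edges

K₄-free K₅-free fewTriangles : List Pattern
K₄-free = (-, P₂+P₃) ∷ (-, diamond) ∷ (-, complete 4) ∷ []
K₅-free = (-, P₂+P₃) ∷ (-, diamond) ∷ (-, complete 5) ∷ []
fewTriangles = (-, P₂+P₃) ∷ (-, diamond) ∷ (-, complete 4)
  ∷ (-, triangles false false false) ∷ (-, triangles true false false)
  ∷ (-, triangles true true false) ∷ (-, triangles true true true) ∷ []

-- The edges between the triangles join vertex 1 to 4 and 2 to 5. The class `thirdᶜ` sees the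
-- unmatched vertices 0 and 3; each side sees one matched vertex of each triangle, from different
-- edges.
noneᶜ thirdᶜ : Vec Bool 6
noneᶜ  = replicate 6 false
thirdᶜ = true ∷ false ∷ false ∷ true ∷ false ∷ false ∷ []

sideᶜ : Bool → Vec Bool 6
sideᶜ true  = false ∷ false ∷ true ∷ false ∷ true ∷ false ∷ []
sideᶜ false = false ∷ true ∷ false ∷ false ∷ false ∷ true ∷ []

almostPrism : Tri 6
almostPrism = triangles true true false

abstract
  four-classes : ∀ c → Excluded K₄-free (c , almostPrism) ⊎ c ∈ noneᶜ ∷ thirdᶜ ∷ sideᶜ true ∷ sideᶜ false ∷ []
  four-classes c = Sum.map by-search (λ eq → toWitness {a? = listed? c} (subst T (sym eq) tt)) (∨-elim (excluded K₄-free (c , almostPrism)) (every-∈ {p = classified} checked (∈-allVecs c)))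
    where
    listed? : (c : Vec Bool 6) → Dec (c ∈ noneᶜ ∷ thirdᶜ ∷ sideᶜ true ∷ sideᶜ false ∷ [])
    listed? c = Any.any? (≡-dec _≟ᵇ_ c) _

    classified : Vec Bool 6 → Bool
    classified c = excluded K₄-free (c , almostPrism) ∨ isYes (listed? c)

    checked : every classified (allVecs 6) ≡ true
    checked = refl

  third-clique : Excluded K₄-free (false ∷ thirdᶜ , thirdᶜ , almostPrism)
  third-clique = by-search refl

  none-independent : Excluded K₄-free (true ∷ noneᶜ , noneᶜ , almostPrism)
  none-independent = by-search refl

  side-independent : ∀ s → Excluded K₄-free (true ∷ sideᶜ s , sideᶜ s , almostPrism)
  side-independent true  = by-search refl
  side-independent false = by-search refl

  none-matched : ∀ s → Excluded K₄-free (false ∷ true ∷ sideᶜ s , true ∷ sideᶜ s , noneᶜ , almostPrism)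
  none-matched true  = by-search refl
  none-matched false = by-search refl

  side-matched : ∀ s → Excluded K₄-free (false ∷ true ∷ noneᶜ , true ∷ noneᶜ , sideᶜ s , almostPrism)
  side-matched true  = by-search refl
  side-matched false = by-search refl

  -- Makes a side vertex with a neighbour in `noneᶜ` adjacent to every vertex of the other side that
  -- misses this neighbour.
  matched-complete : ∀ s → Excluded K₄-free (false ∷ false ∷ sideᶜ (not s) , true ∷ noneᶜ , sideᶜ s , almostPrism)
  matched-complete true  = by-search refl
  matched-complete false = by-search refl

isSame : Rel → Bool
isSame same = true
isSame _    = false

-- The flags tell whether the two ends have a neighbour in `noneᶜ`, their cap. Without caps the
-- bipartite rule applies; with a common cap, which at most one vertex on each side has, the bit of
-- the first end decides; all other pairs are adjacent.
core : Bool → Fin 3 → Bool → Bool → Bool → Rel → Bool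
core false m _ false z r    = ψ m z r
core true  _ s true  _ same = s
core _     _ _ _     _ _    = true

-- Types: the class noneᶜ; otherwise the side, whether there is a neighbour in noneᶜ, and data for core.
almostPrismScheme : Scheme
almostPrismScheme = record
  { Type = ⊤ ⊎ Bool × Bool × Fin 3 × Bool
  ; finite = finite-⊎ finite-⊤ (finite-× finite-Bool (finite-× finite-Bool (finite-× (finite-Fin 3) finite-Bool)))
  ; φ = λ { (inj₁ _) (inj₁ _) _ → false
          ; (inj₁ _) (inj₂ (_ , k , _)) r → k ∧ isSame r
          ; (inj₂ (_ , k , _)) (inj₁ _) r → k ∧ isSame r
          ; (inj₂ (true , k , m , s)) (inj₂ (false , k′ , _ , z)) r → core k m s k′ z r
          ; (inj₂ (false , k′ , _ , z)) (inj₂ (true , k , m , s)) r → core k m s k′ z (converse r)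
          ; _ _ _ → false } }

module AlmostPrism (em : ExcludedMiddle 0ℓ) (G : Graph) (avoids : All (Avoids G) K₄-free) where
  open Graph G using (adj; adj-sym; adj-irrefl)

  private
    no-P₂+P₃ : Avoids G (5 , P₂+P₃)
    no-P₂+P₃ = All.head avoids
    no-diamond : Avoids G (4 , diamond)
    no-diamond = All.head (All.tail avoids)
    no-K₄ : Avoids G (4 , complete 4)
    no-K₄ = All.head (All.tail (All.tail avoids))

  open Forbidden G no-diamond no-P₂+P₃

  module _ (fs : Vec (Vertex G) 6) (distinct : Distinct fs) (fs-matrix : matrix G fs ≡ almostPrism) where
    private
      V = Vertex G

      Fresh : V → Set
      Fresh v = Allᵛ.All (v ≢_) fs

      class : V → Vec Bool 6
      class v = map (adj v) fs

      In : Vec Bool 6 → V → Set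
      In c v = Fresh v × class v ≡ c

      two : ∀ {c d b u v} → In c u → In d v → v ≢ u → adj v u ≡ b →
        ¬ Excluded K₄-free (b ∷ d , c , almostPrism)
      two {u = u} {v} (u∉ , refl) (v∉ , refl) v≢u refl =
        subst (λ M → ¬ Excluded K₄-free (adj v u ∷ class v , class u , M)) fs-matrix
          (¬excluded G {vs = v ∷ u ∷ fs} (v≢u ∷ v∉ , u∉ , distinct) avoids)

      three : ∀ {c d e b₁ b₂ b₃ u v w} → In c u → In d v → In e w → v ≢ u → w ≢ v → w ≢ u →
        adj v u ≡ b₁ → adj w v ≡ b₂ → adj w u ≡ b₃ →
        ¬ Excluded K₄-free (b₂ ∷ b₃ ∷ e , b₁ ∷ d , c , almostPrism)
      three {u = u} {v} {w} (u∉ , refl) (v∉ , refl) (w∉ , refl) v≢u w≢v w≢u refl refl refl =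
        subst (λ M → ¬ Excluded K₄-free (adj w v ∷ adj w u ∷ class w , adj v u ∷ class v , class u , M)) fs-matrix
          (¬excluded G {vs = w ∷ v ∷ u ∷ fs} (w≢v ∷ w≢u ∷ w∉ , v≢u ∷ v∉ , u∉ , distinct) avoids)

      independent : ∀ {c} → Excluded K₄-free (true ∷ c , c , almostPrism) →
        ∀ {u v} → In c u → In c v → adj u v ≡ false
      independent ex cu cv = ¬true⇒false λ uv → two cv cu (adj⇒≢ uv) uv ex

      matched : ∀ {c d} → Excluded K₄-free (true ∷ d , d , almostPrism) →
        Excluded K₄-free (false ∷ true ∷ d , true ∷ d , c , almostPrism) →
        ∀ {u v w} → In c u → In d v → In d w → adj v u ≡ true → adj w u ≡ true → v ≡ w
      matched ex ex′ {u} {v} {w} cu dv dw vu wu with v Fin.≟ w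
      ... | yes eq = eq
      ... | no v≢w = ⊥-elim (three cu dv dw (adj⇒≢ vu) (v≢w ∘ sym) (adj⇒≢ wu) vu (independent ex dw dv) wu ex′)

      sides-differ : ∀ s {v} → class v ≡ sideᶜ s → class v ≢ sideᶜ (not s)
      sides-differ true  eq eq′ with trans (sym eq) eq′
      ... | ()
      sides-differ false eq eq′ with trans (sym eq) eq′
      ... | ()

      none≢side : ∀ s → noneᶜ ≢ sideᶜ s
      none≢side true  ()
      none≢side false ()

      side-apart : ∀ s {c v} → In noneᶜ c → In (sideᶜ s) v → v ≢ c
      side-apart s (_ , cc) (_ , cv) refl = none≢side s (trans (sym cc) cv)

      complete-to : ∀ s {u c v} → In (sideᶜ s) u → In noneᶜ c → In (sideᶜ (not s)) v →
        adj u c ≡ true → adj v c ≡ false → adj v u ≡ true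
      complete-to s {u} {c} {v} su nc s′v uc vc with adj v u in vu
      ... | true = refl
      ... | false = ⊥-elim (three su nc s′v (side-apart s nc su ∘ sym) (side-apart (not s) nc s′v)
              (λ { refl → sides-differ s (proj₂ su) (proj₂ s′v) }) (flip uc) vc vu (matched-complete s))

      Capped : V → Set
      Capped v = ∃ λ c → In noneᶜ c × adj v c ≡ true

      Uncapped : Bool → V → Set
      Uncapped s v = In (sideᶜ s) v × ¬ Capped v

      uncapped : Bool → V → Bool
      uncapped s v = does (em {Uncapped s v})

      uncapped-elim : ∀ s {v} → uncapped s v ≡ true → Uncapped s v
      uncapped-elim s {v} eq with em {Uncapped s v}
      ... | yes u = u

      uncapped-intro : ∀ s {v} → Uncapped s v → uncapped s v ≡ true
      uncapped-intro s {v} u with em {Uncapped s v}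
      ... | yes _ = refl
      ... | no ¬u = ⊥-elim (¬u u)

      module Bip = Bipartite em G no-diamond no-P₂+P₃ (uncapped true) (uncapped false)
        (λ u → ¬true⇒false λ u′ → sides-differ true (proj₂ (proj₁ (uncapped-elim true u))) (proj₂ (proj₁ (uncapped-elim false u′))))
        (λ u v → independent (side-independent true) (proj₁ (uncapped-elim true u)) (proj₁ (uncapped-elim true v)))
        (λ u v → independent (side-independent false) (proj₁ (uncapped-elim false u)) (proj₁ (uncapped-elim false v)))

      Type : Set
      Type = Scheme.Type almostPrismScheme

      -- At most one vertex of the false side has cap `c`, so one bit of the type of `v` can record
      -- adjacency to it.
      Tip : V → V → Set
      Tip v c = ∃ λ w → In (sideᶜ false) w × adj w c ≡ true × adj v w ≡ true

      data Shape (v : V) : Type → ℕ × ℕ → Set where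
        none  : In noneᶜ v → Shape v (inj₁ tt) (0 , toℕ v)
        capped : ∀ s {c} (tip? : Dec (Tip v c)) → In (sideᶜ s) v → In noneᶜ c → adj v c ≡ true →
                 Shape v (inj₂ (s , true , 0F , does tip?)) (0 , toℕ c)
        bare  : ∀ s → Uncapped s v → Shape v (inj₂ (s , false , Bip.mode v , Bip.inZ v)) (Bip.addr v)

      shapeSide : ∀ s {v} → In (sideᶜ s) v → ∃₂ (Shape v)
      shapeSide s {v} sv with em {Capped v}
      ... | yes (c , nc , vc) = -, -, capped s em sv nc vc
      ... | no ¬capped = -, -, bare s (sv , ¬capped)

      Deleted : V → Set
      Deleted v = v ∈ toList fs ⊎ In thirdᶜ v

      deleted-small : Small (6 + 4) Deleted
      deleted-small = small-∪ (small-≤ (ℕₚ.≤-reflexive (length-toList fs)) (small-list (toList fs)))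
        (Anchored.clique-small em G no-K₄ (In thirdᶜ) λ {u} {v} u-in v-in u≢v → third-adjacent u-in v-in u≢v)
        where
        third-adjacent : ∀ {u v} → In thirdᶜ u → In thirdᶜ v → u ≢ v → adj u v ≡ true
        third-adjacent {u} {v} iu iv u≢v with adj u v in uv
        ... | true = refl
        ... | false = ⊥-elim (two iv iu u≢v uv third-clique)

      shape : ∀ {v} → ¬ Deleted v → ∃₂ (Shape v)
      shape {v} ¬d with ∈-or-fresh v fs
      ... | inj₁ v∈ = ⊥-elim (¬d (inj₁ v∈))
      ... | inj₂ v∉ with four-classes (class v)
      ... | inj₁ ex = ⊥-elim (subst (λ M → ¬ Excluded K₄-free (class v , M)) fs-matrix
                        (¬excluded G {vs = v ∷ fs} (v∉ , distinct) avoids) ex)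
      ... | inj₂ (here cv) = -, -, none (v∉ , cv)
      ... | inj₂ (there (here cv)) = ⊥-elim (¬d (inj₂ (v∉ , cv)))
      ... | inj₂ (there (there (here cv))) = shapeSide true (v∉ , cv)
      ... | inj₂ (there (there (there (here cv)))) = shapeSide false (v∉ , cv)

      describe : ∀ v → ∃₂ λ t a → ¬ Deleted v → Shape v t a
      describe v with em {Deleted v}
      -- A placeholder, as nothing is claimed about deleted vertices.
      ... | yes d = inj₁ tt , (0 , 0) , λ ¬d → ⊥-elim (¬d d)
      ... | no ¬d = let t , a , s = shape ¬d in t , a , λ _ → s

      module S = Scheme almostPrismScheme

      cap-unique : ∀ s {v c c′} → In (sideᶜ s) v → In noneᶜ c → In noneᶜ c′ → adj v c ≡ true → adj v c′ ≡ true → c ≡ c′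
      cap-unique s sv nc nc′ vc vc′ = matched none-independent (side-matched s) sv nc nc′ (flip vc) (flip vc′)

      none–side : ∀ {u v t a} → In noneᶜ u → (∀ s → In (sideᶜ s) v → Shape v t a → adj v u ≡ S.φ t (inj₁ tt) (rel a (0 , toℕ u)))
      none–side {u} nu s sv (none nv) = ⊥-elim (none≢side s (trans (sym (proj₂ nv)) (proj₂ sv)))
      none–side {u} nu s sv (capped s′ {c} _ sv′ nc vc) with c Fin.≟ u
      ... | yes refl = trans vc (sym (cong isSame (rel-same {0 , toℕ c} {0 , toℕ c} refl refl)))
      ... | no c≢u = trans (¬true⇒false λ vu → c≢u (cap-unique s′ sv′ nc nu vc vu))
                       (sym (cong isSame (rel-apart {0 , toℕ c} {0 , toℕ u} refl (c≢u ∘ toℕ-injective))))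
      none–side {u} nu s sv (bare _ (_ , ¬cap)) = ¬true⇒false λ vu → ¬cap (_ , nu , vu)

      across : ∀ {u v t a t′ a′} → In (sideᶜ true) u → In (sideᶜ false) v → Shape u t a → Shape v t′ a′ →
        adj u v ≡ S.φ t t′ (rel a a′)
      across su sv (none nu) _ = ⊥-elim (none≢side true (trans (sym (proj₂ nu)) (proj₂ su)))
      across su sv _ (none nv) = ⊥-elim (none≢side false (trans (sym (proj₂ nv)) (proj₂ sv)))
      across su sv (capped false _ su′ _ _) _ = ⊥-elim (sides-differ true (proj₂ su) (proj₂ su′))
      across su sv (bare false (su′ , _)) _ = ⊥-elim (sides-differ true (proj₂ su) (proj₂ su′))
      across su sv _ (capped true _ sv′ _ _) = ⊥-elim (sides-differ true (proj₂ sv′) (proj₂ sv))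
      across su sv _ (bare true (sv′ , _)) = ⊥-elim (sides-differ true (proj₂ sv′) (proj₂ sv))
      across su sv (bare true bu) (bare false bv) = Bip.adj-ψ (uncapped-intro true bu) (uncapped-intro false bv)
      across su sv (bare true (_ , ¬cap)) (capped false _ _ nc vc) =
        complete-to false sv nc su vc (¬true⇒false λ uc → ¬cap (_ , nc , uc))
      across su sv (capped true _ _ nc uc) (bare false (_ , ¬cap)) =
        flip (complete-to true su nc sv uc (¬true⇒false λ vc → ¬cap (_ , nc , vc)))
      across {u} {v} su sv (capped true {c} tip? _ nc uc) (capped false {c′} _ _ nc′ vc′) with c Fin.≟ c′
      ... | yes refl = trans (tip-adj tip?) (sym (cong (core true 0F (does tip?) true _) (rel-same {0 , toℕ c} {0 , toℕ c} refl refl)))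
        where
        tip-adj : (d : Dec (Tip u c)) → adj u v ≡ does d
        tip-adj (no ¬tip) = ¬true⇒false λ uv → ¬tip (v , sv , vc′ , uv)
        tip-adj (yes (w , sw , wc , uw)) =
          subst (λ w → adj u w ≡ true) (matched (side-independent false) (none-matched false) nc sw sv wc vc′) uw
      ... | no c≢c′ = trans adjacent (sym (cong (core true 0F (does tip?) true _) (rel-apart {0 , toℕ c} {0 , toℕ c′} refl (c≢c′ ∘ toℕ-injective))))
        where
        adjacent : adj u v ≡ true
        adjacent with adj v c in vc
        ... | true = ⊥-elim (c≢c′ (cap-unique false sv nc nc′ vc vc′))
        ... | false = flip (complete-to true su nc sv uc vc)

      isSame-converse : ∀ r → isSame (converse r) ≡ isSame r
      isSame-converse before = refl
      isSame-converse after  = refl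
      isSame-converse same   = refl
      isSame-converse apart  = refl

      converse-involutive : ∀ r → converse (converse r) ≡ r
      converse-involutive before = refl
      converse-involutive after  = refl
      converse-involutive same   = refl
      converse-involutive apart  = refl

      φ-converse : ∀ t t′ r → S.φ t t′ (converse r) ≡ S.φ t′ t r
      φ-converse (inj₁ _) (inj₁ _) r = refl
      φ-converse (inj₁ _) (inj₂ (_ , k , _)) r = cong (k ∧_) (isSame-converse r)
      φ-converse (inj₂ (_ , k , _)) (inj₁ _) r = cong (k ∧_) (isSame-converse r)
      φ-converse (inj₂ (true , _)) (inj₂ (false , _)) r = refl
      φ-converse (inj₂ (false , k′ , _ , z)) (inj₂ (true , k , m , s)) r = cong (core k m s k′ z) (converse-involutive r)
      φ-converse (inj₂ (true , _)) (inj₂ (true , _)) r = refl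
      φ-converse (inj₂ (false , _)) (inj₂ (false , _)) r = refl

      φ-same-side : ∀ s {x y} r → S.φ (inj₂ (s , x)) (inj₂ (s , y)) r ≡ false
      φ-same-side true  _ = refl
      φ-same-side false _ = refl

      Adjacency : V → V → Type → ℕ × ℕ → Type → ℕ × ℕ → Set
      Adjacency u v t a t′ a′ = adj u v ≡ S.φ t t′ (rel a a′)

      symmetric : ∀ {u v t a t′ a′} → Adjacency u v t a t′ a′ → Adjacency v u t′ a′ t a
      symmetric {t = t} {a} {t′} {a′} eq = trans (flip eq)
        (trans (sym (φ-converse t′ t (rel a a′))) (cong (S.φ t′ t) (sym (rel-converse a a′))))

      -- Forgets caps, so that only the pairs of opposite sides require a distinction of shapes.
      data Kind (v : V) : Type → ℕ × ℕ → Set where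
        noneᵏ : In noneᶜ v → Kind v (inj₁ tt) (0 , toℕ v)
        sideᵏ : ∀ s {x a} → In (sideᶜ s) v → Kind v (inj₂ (s , x)) a

      kind : ∀ {v t a} → Shape v t a → Kind v t a
      kind (none nv) = noneᵏ nv
      kind (capped s _ sv _ _) = sideᵏ s sv
      kind (bare s (sv , _)) = sideᵏ s sv

      adj-shape : ∀ {u v t a t′ a′} → Shape u t a → Shape v t′ a′ → Adjacency u v t a t′ a′
      adj-shape sh sh′ with kind sh | kind sh′
      ... | noneᵏ nu | noneᵏ nv = independent none-independent nu nv
      ... | noneᵏ nu | sideᵏ s {x} {a} sv = symmetric {t = inj₂ (s , x)} {a} {inj₁ tt} (none–side nu s sv sh′)
      ... | sideᵏ s su | noneᵏ nv = none–side nv s su sh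
      ... | sideᵏ true su | sideᵏ false sv = across su sv sh sh′
      ... | sideᵏ false {x} {a} su | sideᵏ true {x′} {a′} sv = symmetric {t = inj₂ (true , x′)} {a′} {inj₂ (false , x)} {a} (across sv su sh′ sh)
      ... | sideᵏ true {x} {a} su | sideᵏ true {x′} {a′} sv =
        trans (independent (side-independent true) su sv) (sym (φ-same-side true {x} {x′} (rel a a′)))
      ... | sideᵏ false {x} {a} su | sideᵏ false {x′} {a′} sv =
        trans (independent (side-independent false) su sv) (sym (φ-same-side false {x} {x′} (rel a a′)))

    almostPrism-rep : Rep (addVertices (6 + 4) almostPrismScheme) G (λ _ → ⊥)
    almostPrism-rep = undelete-small (6 + 4) deleted-small record
      { type = λ v → proj₁ (describe v)
      ; addr = λ v → proj₁ (proj₂ (describe v))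
      ; adj-φ = λ u v ¬u ¬v _ → adj-shape (proj₂ (proj₂ (describe u)) ¬u) (proj₂ (proj₂ (describe v)) ¬v) }

-- Graphs with a large clique

-- With this default the deviating pairs are the edges, so the cluster scheme describes disjoint
-- unions of cliques.
edgeless : ⊤ → ⊤ → Bool
edgeless _ _ = false

-- Types: a vertex of the clique K; otherwise membership in the only nontrivial component outside
-- K, and whether there is a neighbour in K.
hubScheme : Scheme
hubScheme = record
  { Type = ⊤ ⊎ Bool × Bool
  ; finite = finite-⊎ finite-⊤ (finite-× finite-Bool finite-Bool)
  ; φ = λ { (inj₁ _) (inj₁ _) _ → true
          ; (inj₁ _) (inj₂ (_ , k)) r → k ∧ isSame r
          ; (inj₂ (_ , k)) (inj₁ _) r → k ∧ isSame r
          ; (inj₂ (q , _)) (inj₂ (q′ , _)) _ → q ∧ q′ } }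

module BigClique (em : ExcludedMiddle 0ℓ) (G : Graph)
  (no-diamond : Avoids G (4 , diamond)) (no-P₂+P₃ : Avoids G (5 , P₂+P₃)) where
  open Graph G using (adj; adj-sym; adj-irrefl)
  open Forbidden G no-diamond no-P₂+P₃
  open Classical em

  private
    V = Vertex G

  module _ (k₁ k₂ k₃ k₄ k₅ : V) (distinct : Distinct (k₁ ∷ k₂ ∷ k₃ ∷ k₄ ∷ k₅ ∷ []))
           (ks-matrix : matrix G (k₁ ∷ k₂ ∷ k₃ ∷ k₄ ∷ k₅ ∷ []) ≡ complete 5) where
    private
      near : V → V → Set
      near k v = v ≡ k ⊎ adj v k ≡ true

      -- The unique maximal clique containing the edge k₁k₂.
      K : V → Set
      K v = near k₁ v × near k₂ v

      ks : Vec V 5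
      ks = k₁ ∷ k₂ ∷ k₃ ∷ k₄ ∷ k₅ ∷ []

      ks-adj : ∀ i j → entry (complete 5) i j ≡ true → adj (Vec.lookup ks i) (Vec.lookup ks j) ≡ true
      ks-adj i j eq = trans (sym (entry-matrix G ks i j)) (trans (cong (λ M → entry M i j) ks-matrix) eq)

      k₁k₂ : adj k₁ k₂ ≡ true
      k₁k₂ = ks-adj 0F 1F refl

      K-clique : ∀ {u v} → K u → K v → u ≢ v → adj u v ≡ true
      K-clique (inj₁ refl , _) (inj₁ refl , _) u≢v = ⊥-elim (u≢v refl)
      K-clique (inj₁ refl , _) (inj₂ vk₁ , _) u≢v = flip vk₁
      K-clique (inj₂ uk₁ , _) (inj₁ refl , _) u≢v = uk₁
      K-clique (_ , inj₁ refl) (_ , inj₁ refl) u≢v = ⊥-elim (u≢v refl)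
      K-clique (_ , inj₁ refl) (_ , inj₂ vk₂) u≢v = flip vk₂
      K-clique (_ , inj₂ uk₂) (_ , inj₁ refl) u≢v = uk₂
      K-clique {u} {v} (inj₂ uk₁ , inj₂ uk₂) (inj₂ vk₁ , inj₂ vk₂) u≢v with adj u v in uv
      ... | true = refl
      ... | false = ⊥-elim (¬diamond k₁k₂ (flip uk₁) (flip uk₂) (flip vk₁) (flip vk₂) uv u≢v)

      R : V → Set
      R v = ¬ K v

      -- With two neighbours in `K`, the absence of a diamond would make `v` equal or adjacent to
      -- every vertex of `K`, in particular `k₁` and `k₂`, and so put it in `K`.
      one-neighbour : ∀ {v a b} → R v → K a → K b → adj v a ≡ true → adj v b ≡ true → a ≡ b
      one-neighbour {v} {a} {b} ¬Kv Ka Kb va vb with a Fin.≟ b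
      ... | yes a≡b = a≡b
      ... | no a≢b = ⊥-elim (¬Kv (close (K-k₁) , close K-k₂))
        where
        K-k₁ : K k₁
        K-k₁ = inj₁ refl , inj₂ k₁k₂
        K-k₂ : K k₂
        K-k₂ = inj₂ (flip k₁k₂) , inj₁ refl

        close : ∀ {k} → K k → near k v
        close {k} Kk with v Fin.≟ k | adj v k in vk
        ... | yes v≡k | _ = inj₁ v≡k
        ... | no _ | true = inj₂ refl
        ... | no v≢k | false = ⊥-elim (¬diamond (K-clique Ka Kb a≢b) (flip va) (flip vb)
                (K-clique Ka Kk (separated v (flip va) (flip vk))) (K-clique Kb Kk (separated v (flip vb) (flip vk))) vk v≢k)

      thin : ∀ {n} {Q : V → Set} {p} → R p → (ws : Vec V (suc n)) → Distinct ws → Allᵛ.All (λ w → K w × Q w) ws →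
        Σ (Vec V n) λ ws′ → Distinct ws′ × Allᵛ.All (λ w → K w × Q w × adj p w ≡ false) ws′
      thin {n} {Q} {p} ¬Kp (w ∷ ws) (w∉ , d) ((Kw , Qw) ∷ all) with adj p w in pw
      ... | true = ws , d , nonadjacent ws w∉ all
        where
        nonadjacent : ∀ {n} (ws : Vec V n) → Allᵛ.All (w ≢_) ws → Allᵛ.All (λ w → K w × Q w) ws →
                      Allᵛ.All (λ w → K w × Q w × adj p w ≡ false) ws
        nonadjacent [] [] [] = []
        nonadjacent (v ∷ vs) (w≢v ∷ w∉) ((Kv , Qv) ∷ all) =
          (Kv , Qv , ¬true⇒false λ pv → w≢v (one-neighbour ¬Kp Kw Kv pw pv)) ∷ nonadjacent vs w∉ all
      thin {zero} ¬Kp (w ∷ []) _ _ | false = [] , _ , []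
      thin {suc n} {Q} ¬Kp (w ∷ ws) (w∉ , d) ((Kw , Qw) ∷ all) | false
        with thin {Q = λ v → Q v × w ≢ v} ¬Kp ws d (Allᵛ.map (λ ((Kv , Qv) , w≢v) → Kv , Qv , w≢v) (Allᵛ.zip (all , w∉)))
      ... | ws′ , d′ , all′ = w ∷ ws′
          , (Allᵛ.map (λ (_ , (_ , w≢v) , _) → w≢v) all′ , d′)
          , (Kw , Qw , pw) ∷ Allᵛ.map (λ (Kv , (Qv , _) , pv) → Kv , Qv , pv) all′

      K-member : ∀ {v} → adj k₁ v ≡ true → adj k₂ v ≡ true → K v × ⊤
      K-member k₁v k₂v = (inj₂ (flip k₁v) , inj₂ (flip k₂v)) , tt

      Avoided : V → V → V → V → Set
      Avoided p q r k = K k × adj p k ≡ false × adj q k ≡ false × adj r k ≡ false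

      -- Each of the three vertices spoils at most one of the five vertices of the given clique.
      two-avoided : ∀ {p q r} → R p → R q → R r → ∃₂ λ k k′ → k ≢ k′ × Avoided p q r k × Avoided p q r k′
      two-avoided Rp Rq Rr with thin Rp ks distinct
          (((inj₁ refl , inj₂ k₁k₂) , tt) ∷ ((inj₂ (flip k₁k₂) , inj₁ refl) , tt)
            ∷ K-member (ks-adj 0F 2F refl) (ks-adj 1F 2F refl) ∷ K-member (ks-adj 0F 3F refl) (ks-adj 1F 3F refl)
            ∷ K-member (ks-adj 0F 4F refl) (ks-adj 1F 4F refl) ∷ [])
      ... | ws₄ , d₄ , all₄ with thin Rq ws₄ d₄ all₄
      ... | ws₃ , d₃ , all₃ with thin Rr ws₃ d₃ all₃
      ... | k ∷ k′ ∷ [] , ((k≢k′ ∷ []) , _) , ((Kk , ((_ , pk) , qk) , rk) ∷ (Kk′ , ((_ , pk′) , qk′) , rk′) ∷ []) =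
        k , k′ , k≢k′ , (Kk , pk , qk , rk) , (Kk′ , pk′ , qk′ , rk′)

      R-trans : ∀ {u v w} → R u → R v → R w → adj u v ≡ true → adj v w ≡ true → u ≢ w → adj u w ≡ true
      R-trans {u} {v} {w} Ru Rv Rw uv vw u≢w with adj u w in uw
      ... | true = refl
      ... | false with two-avoided Ru Rv Rw
      ... | k , k′ , k≢k′ , (Kk , uk , vk , wk) , (Kk′ , uk′ , vk′ , wk′) =
        ⊥-elim (¬P₂+P₃ (K-clique Kk Kk′ k≢k′) uv vw uw u≢w
          (flip uk) (flip vk) (flip wk) (flip uk′) (flip vk′) (flip wk′))

      -- A vertex `k` of `K` away from `q` and `q′` gives the induced path from `k` through `x` to
      -- `p`, since `p` has no second neighbour in `K`. Two candidates are needed because one of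
      -- them may be `x`.
      attached : ∀ {x p q q′} → K x → R p → R q → R q′ → adj x p ≡ true → adj q q′ ≡ true →
        adj p q ≡ false → adj p q′ ≡ false → adj x q ≡ false → adj x q′ ≡ false → ⊥
      attached {x} {p} {q} {q′} Kx Rp Rq Rq′ xp qq′ pq pq′ xq xq′ with two-avoided Rq Rq Rq′
      ... | k , k′ , k≢k′ , (Kk , qk , _ , q′k) , (Kk′ , qk′ , _ , q′k′) with k Fin.≟ x
      ... | no k≢x = ¬P₂+P₃ qq′ (K-clique Kk Kx k≢x) xp (¬true⇒false λ kp → k≢x (one-neighbour Rp Kk Kx (flip kp) (flip xp)))
              (λ { refl → Rp Kk }) qk (flip xq) (flip pq) q′k (flip xq′) (flip pq′)
      ... | yes refl = ¬P₂+P₃ qq′ (K-clique Kk′ Kx (k≢k′ ∘ sym)) xp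
              (¬true⇒false λ k′p → k≢k′ (one-neighbour Rp Kk Kk′ (flip xp) (flip k′p)))
              (λ { refl → Rp Kk′ }) qk′ (flip xq) (flip pq) q′k′ (flip xq′) (flip pq′)

      record TwoEdges : Set where
        field
          q q′ r r′ : V
          Rq : R q
          Rq′ : R q′
          Rr : R r
          Rr′ : R r′
          qq′ : adj q q′ ≡ true
          rr′ : adj r r′ ≡ true
          qr : adj q r ≡ false
          qr′ : adj q r′ ≡ false
          q′r : adj q′ r ≡ false
          q′r′ : adj q′ r′ ≡ false

      module _ (e : TwoEdges) where
        open TwoEdges e

        Hub : V → V → Set
        Hub p v = K v × adj p v ≡ true

        hub-small : ∀ {p} → R p → Small 1 (Hub p)
        hub-small {p} Rp with em {∃ (Hub p)}
        ... | yes (k , Kk , pk) = k ∷ [] , ≤-refl , λ (Kv , pv) → here (one-neighbour Rp Kv Kk pv pk)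
        ... | no ¬k = [] , z≤n , λ h → ⊥-elim (¬k (-, h))

        Deleted : V → Set
        Deleted v = (Hub q v ⊎ Hub q′ v) ⊎ (Hub r v ⊎ Hub r′ v)

        -- The edges `qq′` and `rr′` lie in different cliques outside `K`. As `p` touches at most
        -- one of them, `attached` applies to the other.
        K-detached : ∀ {x p} → ¬ Deleted x → K x → R p → adj x p ≡ true → ⊥
        K-detached {x} {p} ¬x Kx Rp xp = meets (touches Rq Rq′ qq′ xq xq′) (touches Rr Rr′ rr′ xr xr′)
          where
          detached : ∀ {s} → (Hub s x → ⊥) → adj x s ≡ false
          detached ¬hub = ¬true⇒false λ xs → ¬hub (Kx , flip xs)

          xq = detached {q} (¬x ∘ inj₁ ∘ inj₁)
          xq′ = detached {q′} (¬x ∘ inj₁ ∘ inj₂)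
          xr = detached {r} (¬x ∘ inj₂ ∘ inj₁)
          xr′ = detached {r′} (¬x ∘ inj₂ ∘ inj₂)

          touches : ∀ {s s′} → R s → R s′ → adj s s′ ≡ true → adj x s ≡ false → adj x s′ ≡ false →
                    adj p s ≡ true ⊎ adj p s′ ≡ true
          touches {s} {s′} Rs Rs′ ss′ xs xs′ with adj p s in ps | adj p s′ in ps′
          ... | true  | _     = inj₁ refl
          ... | false | true  = inj₂ refl
          ... | false | false = ⊥-elim (attached Kx Rp Rs Rs′ xp ss′ ps ps′ xs xs′)

          meet : ∀ {s t t′} → R s → R t → adj p s ≡ true → adj p t ≡ true → adj s t ≡ false → adj s t′ ≡ false → adj t t′ ≡ true → ⊥
          meet {t′ = t′} Rs Rt ps pt st st′ tt′ = true≢false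
            (trans (sym (R-trans Rs Rp Rt (flip ps) pt (separated t′ tt′ st′ ∘ sym))) st)

          meets : adj p q ≡ true ⊎ adj p q′ ≡ true → adj p r ≡ true ⊎ adj p r′ ≡ true → ⊥
          meets (inj₁ pq)  (inj₁ pr)  = meet Rq Rr pq pr qr qr′ rr′
          meets (inj₁ pq)  (inj₂ pr′) = meet Rq Rr′ pq pr′ qr′ qr (flip rr′)
          meets (inj₂ pq′) (inj₁ pr)  = meet Rq′ Rr pq′ pr q′r q′r′ rr′
          meets (inj₂ pq′) (inj₂ pr′) = meet Rq′ Rr′ pq′ pr′ q′r′ q′r (flip rr′)

        live-trans : ∀ {u v w} → ¬ Deleted u → ¬ Deleted v → ¬ Deleted w →
          adj u v ≡ true → adj v w ≡ true → u ≢ w → adj u w ≡ true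
        live-trans {u} {v} {w} ¬u ¬v ¬w uv vw u≢w with em {K u} | em {K v} | em {K w}
        ... | yes Ku | _ | yes Kw = K-clique Ku Kw u≢w
        ... | no Ru | no Rv | no Rw = R-trans Ru Rv Rw uv vw u≢w
        ... | yes Ku | no Rv | _ = ⊥-elim (K-detached ¬u Ku Rv uv)
        ... | no Ru | yes Kv | _ = ⊥-elim (K-detached ¬v Kv Ru (flip uv))
        ... | _ | yes Kv | no Rw = ⊥-elim (K-detached ¬v Kv Rw vw)
        ... | _ | no Rv | yes Kw = ⊥-elim (K-detached ¬w Kw Rv (flip vw))

        clustered : Rep (addVertices 4 (clusterScheme ⊤ finite-⊤ edgeless)) G (λ _ → ⊥)
        clustered = undelete-small 4
          (small-∪ (small-∪ (hub-small Rq) (hub-small Rq′)) (small-∪ (hub-small Rr) (hub-small Rr′)))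
          (cluster finite-⊤ edgeless (λ _ → tt) (λ _ _ → refl) live-trans)

      module _ (¬two : ¬ TwoEdges) where
        REdge : Set
        REdge = ∃₂ λ q q′ → R q × R q′ × adj q q′ ≡ true

        InQ : Dec REdge → V → Set
        InQ (yes (q , _)) v = near q v
        InQ (no _)        v = ⊥

        Q-clique : ∀ d {u v} → R u → R v → u ≢ v → InQ d u → InQ d v → adj u v ≡ true
        Q-clique (yes _) Ru Rv u≢v (inj₁ refl) (inj₁ refl) = ⊥-elim (u≢v refl)
        Q-clique (yes _) Ru Rv u≢v (inj₁ refl) (inj₂ vq) = flip vq
        Q-clique (yes _) Ru Rv u≢v (inj₂ uq) (inj₁ refl) = uq
        Q-clique (yes (q , _ , Rq , _)) Ru Rv u≢v (inj₂ uq) (inj₂ vq) = R-trans Ru Rq Rv uq (flip vq) u≢v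

        Q-edge : ∀ d {u v} → R u → R v → adj u v ≡ true → InQ d u
        Q-edge (no ¬e) Ru Rv uv = ⊥-elim (¬e (-, -, Ru , Rv , uv))
        Q-edge (yes (q , q′ , Rq , Rq′ , qq′)) {u} {v} Ru Rv uv with u Fin.≟ q | adj u q in uq
        ... | yes u≡q | _ = inj₁ u≡q
        ... | no _ | true = inj₂ refl
        ... | no u≢q | false = ⊥-elim (¬two record
          { q = q ; q′ = q′ ; r = u ; r′ = v ; Rq = Rq ; Rq′ = Rq′ ; Rr = Ru ; Rr′ = Rv ; qq′ = qq′ ; rr′ = uv
          ; qr = flip uq ; qr′ = flip vq ; q′r = flip (far Ru u≢q uq) ; q′r′ = flip (far Rv v≢q vq) })
          where
          v≢q : v ≢ q
          v≢q refl = true≢false (trans (sym uv) uq)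

          vq : adj v q ≡ false
          vq = ¬true⇒false λ vq → true≢false (trans (sym (R-trans Ru Rv Rq uv vq u≢q)) uq)

          far : ∀ {w} → R w → w ≢ q → adj w q ≡ false → adj w q′ ≡ false
          far Rw w≢q wq = ¬true⇒false λ wq′ → true≢false (trans (sym (R-trans Rw Rq′ Rq wq′ (flip qq′) w≢q)) wq)

        Hub′ : V → V → Set
        Hub′ v k = K k × adj v k ≡ true

        q? : Dec REdge
        q? = em

        code : (v : V) → Dec (K v) → Dec (∃ (Hub′ v)) → (⊤ ⊎ Bool × Bool) × (ℕ × ℕ)
        code v (yes _) _ = inj₁ tt , (0 , toℕ v)
        code v (no _) (yes (k , _)) = inj₂ (does (em {InQ q? v}) , true) , (0 , toℕ k)
        -- The block is arbitrary: the flag `false` already gives nonadjacency to all of `K`, and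
        -- pairs outside `K` ignore addresses.
        code v (no _) (no _) = inj₂ (does (em {InQ q? v}) , false) , (0 , 0)

        Adjacency : V → V → (⊤ ⊎ Bool × Bool) × (ℕ × ℕ) → (⊤ ⊎ Bool × Bool) × (ℕ × ℕ) → Set
        Adjacency u v (t , a) (t′ , a′) = adj u v ≡ Scheme.φ hubScheme t t′ (rel a a′)

        R-adjacency : ∀ {u v} → R u → R v → u ≢ v → adj u v ≡ does (em {InQ q? u}) ∧ does (em {InQ q? v})
        R-adjacency {u} {v} Ru Rv u≢v with em {InQ q? u} | em {InQ q? v}
        ... | yes Qu | yes Qv = Q-clique q? Ru Rv u≢v Qu Qv
        ... | no ¬Qu | _ = ¬true⇒false λ uv → ¬Qu (Q-edge q? Ru Rv uv)
        ... | yes _ | no ¬Qv = ¬true⇒false λ uv → ¬Qv (Q-edge q? Rv Ru (flip uv))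

        hub-adjacency : ∀ {x v k} → K x → R v → Hub′ v k → ∀ a a′ → a ≡ (0 , toℕ x) → a′ ≡ (0 , toℕ k) →
          adj x v ≡ isSame (rel a a′) × adj v x ≡ isSame (rel a′ a)
        hub-adjacency {x} {v} {k} Kx Rv (Kk , vk) a a′ refl refl with x Fin.≟ k
        ... | yes refl = trans (flip vk) eq , trans vk eq
          where eq = sym (cong isSame (rel-same {0 , toℕ x} {0 , toℕ x} refl refl))
        ... | no x≢k = trans (flip vx) (sym (cong isSame (rel-apart {a} {a′} refl (x≢k ∘ toℕ-injective))))
                     , trans vx (sym (cong isSame (rel-apart {a′} {a} refl (x≢k ∘ sym ∘ toℕ-injective))))
          where
          vx : adj v x ≡ false
          vx = ¬true⇒false λ vx → x≢k (one-neighbour Rv Kx Kk vx vk)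

        adj-code : ∀ {u v} → u ≢ v → ∀ ku hu kv hv → Adjacency u v (code u ku hu) (code v kv hv)
        adj-code u≢v (yes Ku) _ (yes Kv) _ = K-clique Ku Kv u≢v
        adj-code u≢v (yes Ku) _ (no Rv) (yes (k , h)) = proj₁ (hub-adjacency Ku Rv h _ _ refl refl)
        adj-code u≢v (yes Ku) _ (no Rv) (no ¬h) = ¬true⇒false λ uv → ¬h (_ , Ku , flip uv)
        adj-code u≢v (no Ru) (yes (k , h)) (yes Kv) _ = proj₂ (hub-adjacency Kv Ru h _ _ refl refl)
        adj-code u≢v (no Ru) (no ¬h) (yes Kv) _ = ¬true⇒false λ uv → ¬h (_ , Kv , uv)
        adj-code u≢v (no Ru) (yes _) (no Rv) (yes _) = R-adjacency Ru Rv u≢v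
        adj-code u≢v (no Ru) (yes _) (no Rv) (no _) = R-adjacency Ru Rv u≢v
        adj-code u≢v (no Ru) (no _) (no Rv) (yes _) = R-adjacency Ru Rv u≢v
        adj-code u≢v (no Ru) (no _) (no Rv) (no _) = R-adjacency Ru Rv u≢v

        hubbed : Rep hubScheme G (λ _ → ⊥)
        hubbed = record
          { type = λ v → proj₁ (code v em em)
          ; addr = λ v → proj₂ (code v em em)
          ; adj-φ = λ u v _ _ u≢v → adj-code u≢v (em {K u}) em (em {K v}) em }

    bigClique′ : Rep (addVertices 4 (clusterScheme ⊤ finite-⊤ edgeless) ⊕ˢ hubScheme) G (λ _ → ⊥)
    bigClique′ with em {TwoEdges}
    ... | yes e = inˡ (clustered e)
    ... | no ¬e = inʳ (hubbed ¬e)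

  bigClique : Contains G (complete 5) → Rep (addVertices 4 (clusterScheme ⊤ finite-⊤ edgeless) ⊕ˢ hubScheme) G (λ _ → ⊥)
  bigClique (k₁ ∷ k₂ ∷ k₃ ∷ k₄ ∷ k₅ ∷ [] , distinct , eq) = bigClique′ k₁ k₂ k₃ k₄ k₅ distinct eq

-- Results of the searches and the case distinction

abstract
  check-K₄ : Checked K₅-free (complete 4)
  check-K₄ = by-check refl

  check-2K₃ : Checked K₄-free (triangles false false false)
  check-2K₃ = by-check refl

  check-2K₃+e : Checked K₄-free (triangles true false false)
  check-2K₃+e = by-check refl

  check-prism : Checked K₄-free (triangles true true true)
  check-prism = by-check refl

  check-C₅ : Checked fewTriangles C₅
  check-C₅ = by-check refl

  -- A vertex with two neighbours in a triangle creates a diamond or `complete 4`, so only matchings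
  -- can join disjoint triangles, and these are the four listed patterns. Hence every triangle meets
  -- a given one, and deleting that one destroys them all.
  disjoint-triangles : ∀ r s t → Excluded fewTriangles (true ∷ true ∷ t , true ∷ s , r , complete 3)
  disjoint-triangles r s t =
    by-search (every-∈ {p = λ t → excluded fewTriangles (true ∷ true ∷ t , true ∷ s , r , complete 3)}
      (every-∈ {p = λ s → every (λ t → excluded fewTriangles (true ∷ true ∷ t , true ∷ s , r , complete 3)) (allVecs 3)}
        (every-∈ {p = λ r → every (λ s → every (λ t → excluded fewTriangles (true ∷ true ∷ t , true ∷ s , r , complete 3)) (allVecs 3)) (allVecs 3)}
          {xs = allVecs 3} refl (∈-allVecs r)) (∈-allVecs s)) (∈-allVecs t))

-- The arguments 5 and 4 of the anchored schemes are sizes of excluded cliques. The numbers of added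
-- vertices stand for the neighbours in the clique of the four ends of two edges, for the six anchor
-- vertices and a clique of class `thirdᶜ`, and for a triangle.
scheme : Scheme
scheme = (addVertices 4 (clusterScheme ⊤ finite-⊤ edgeless) ⊕ˢ hubScheme)
      ⊕ˢ Anchor.scheme K₅-free (complete 4) 5
      ⊕ˢ Anchor.scheme K₄-free (triangles false false false) 4
      ⊕ˢ Anchor.scheme K₄-free (triangles true false false) 4
      ⊕ˢ Anchor.scheme K₄-free (triangles true true true) 4
      ⊕ˢ addVertices (6 ℕ.+ 4) almostPrismScheme
      ⊕ˢ Anchor.scheme fewTriangles C₅ 4
      ⊕ˢ addVertices 3 bipartiteScheme

module _ (em : ExcludedMiddle 0ℓ) (G : Graph) (no-diamond : Avoids G (4 , diamond)) (no-P₂+P₃ : Avoids G (5 , P₂+P₃)) where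
  open Graph G using (adj)
  open Forbidden G no-diamond no-P₂+P₃

  triangle-matrix : ∀ {a b c} → adj a b ≡ true → adj b c ≡ true → adj a c ≡ true → matrix G (c ∷ b ∷ a ∷ []) ≡ complete 3
  triangle-matrix ab bc ac = cong₂ _,_ (cong₂ _∷_ (flip bc) (cong (_∷ []) (flip ac))) (cong₂ _,_ (cong (_∷ []) (flip ab)) refl)

  triangle-distinct : ∀ {a b c} → adj a b ≡ true → adj b c ≡ true → adj a c ≡ true → Distinct (c ∷ b ∷ a ∷ [])
  triangle-distinct ab bc ac = (adj⇒≢ (flip bc) ∷ adj⇒≢ (flip ac) ∷ []) , (adj⇒≢ (flip ab) ∷ []) , [] , tt

  nearlyBipartite : All (Avoids G) fewTriangles → Avoids G (5 , C₅) → Rep (addVertices 3 bipartiteScheme) G (λ _ → ⊥)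
  nearlyBipartite avoids no-C₅ with em {Contains G (complete 3)}
  ... | no ¬triangle = undelete-small 3 ([] , z≤n , λ ()) (TwoColour.twoColoured em G no-diamond no-P₂+P₃ no-C₅ (λ _ → ⊥)
          λ _ _ _ ab bc ac → ¬triangle (-, triangle-distinct ab bc ac , triangle-matrix ab bc ac))
  ... | yes (ts@(_ ∷ _ ∷ _ ∷ []) , ts-distinct , ts-matrix) = undelete-small 3 (small-list (toList ts))
          (TwoColour.twoColoured em G no-diamond no-P₂+P₃ no-C₅ (_∈ toList ts) no-triangle)
    where
    fresh : ∀ {v} → ¬ v ∈ toList ts → Allᵛ.All (v ≢_) ts
    fresh {v} v∉ with ∈-or-fresh v ts
    ... | inj₁ v∈ = ⊥-elim (v∉ v∈)
    ... | inj₂ f = f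

    no-triangle : ∀ {a b c} → ¬ a ∈ toList ts → ¬ b ∈ toList ts → ¬ c ∈ toList ts →
                  adj a b ≡ true → adj b c ≡ true → adj a c ≡ true → ⊥
    no-triangle {a} {b} {c} a∉ b∉ c∉ ab bc ac = ¬excluded G {vs = c ∷ b ∷ a ∷ ts}
      ( adj⇒≢ (flip bc) ∷ adj⇒≢ (flip ac) ∷ fresh c∉
      , adj⇒≢ (flip ab) ∷ fresh b∉
      , fresh a∉
      , ts-distinct)
      avoids
      (subst (Excluded fewTriangles)
        (cong₂ _,_ (cong₂ _∷_ (sym (flip bc)) (cong (_∷ map (adj c) ts) (sym (flip ac))))
          (cong₂ _,_ (cong (_∷ map (adj b) ts) (sym (flip ab))) (cong (map (adj a) ts ,_) (sym ts-matrix))))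
        (disjoint-triangles (map (adj a) ts) (map (adj b) ts) (map (adj c) ts)))

  private
    split : (A : Set) → (A → Rep scheme G (λ _ → ⊥)) → (¬ A → Rep scheme G (λ _ → ⊥)) → Rep scheme G (λ _ → ⊥)
    split A yes-case no-case with em {A}
    ... | yes a = yes-case a
    ... | no ¬a = no-case ¬a

    avoid : ∀ {n} {P : Tri n} → ¬ Contains G P → Avoids G (n , P)
    avoid ¬P ws d m = ¬P (ws , d , m)

  module _ (no-K₅ : Avoids G (5 , complete 5)) where
    avoids-K₅ : All (Avoids G) K₅-free
    avoids-K₅ = no-P₂+P₃ ∷ no-diamond ∷ no-K₅ ∷ []

    rep-K₄ : Contains G (complete 4) → Rep (Anchor.scheme K₅-free (complete 4) 5) G (λ _ → ⊥)
    rep-K₄ = Anchored.anchored em G no-K₅ avoids-K₅ check-K₄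

  module _ (no-K₄ : Avoids G (4 , complete 4)) where
    avoids-K₄ : All (Avoids G) K₄-free
    avoids-K₄ = no-P₂+P₃ ∷ no-diamond ∷ no-K₄ ∷ []

    rep-triangles : ∀ {x y z} → Checked K₄-free (triangles x y z) → Contains G (triangles x y z) →
                    Rep (Anchor.scheme K₄-free (triangles x y z) 4) G (λ _ → ⊥)
    rep-triangles = Anchored.anchored em G no-K₄ avoids-K₄

    rep-almostPrism : Contains G almostPrism → Rep (addVertices (6 ℕ.+ 4) almostPrismScheme) G (λ _ → ⊥)
    rep-almostPrism (fs , d , m) = AlmostPrism.almostPrism-rep em G avoids-K₄ fs d m

    module _ (f₀ : ¬ Contains G (triangles false false false)) (f₁ : ¬ Contains G (triangles true false false))
             (f₂ : ¬ Contains G almostPrism) (f₃ : ¬ Contains G (triangles true true true)) where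
      few : All (Avoids G) fewTriangles
      few = no-P₂+P₃ ∷ no-diamond ∷ no-K₄ ∷ avoid f₀ ∷ avoid f₁ ∷ avoid f₂ ∷ avoid f₃ ∷ []

      rep-C₅ : Contains G C₅ → Rep (Anchor.scheme fewTriangles C₅ 4) G (λ _ → ⊥)
      rep-C₅ = Anchored.anchored em G no-K₄ few check-C₅

    represented-K₄-free : Rep scheme G (λ _ → ⊥)
    represented-K₄-free =
      split (Contains G (triangles false false false)) (λ F → inʳ (inʳ (inˡ (rep-triangles check-2K₃ F)))) λ f₀ →
      split (Contains G (triangles true false false)) (λ F → inʳ (inʳ (inʳ (inˡ (rep-triangles check-2K₃+e F))))) λ f₁ →
      split (Contains G almostPrism) (λ F → inʳ (inʳ (inʳ (inʳ (inʳ (inˡ (rep-almostPrism F))))))) λ f₂ →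
      split (Contains G (triangles true true true)) (λ F → inʳ (inʳ (inʳ (inʳ (inˡ (rep-triangles check-prism F)))))) λ f₃ →
      split (Contains G C₅) (λ F → inʳ (inʳ (inʳ (inʳ (inʳ (inʳ (inˡ (rep-C₅ f₀ f₁ f₂ f₃ F)))))))) λ no-C₅ →
      inʳ (inʳ (inʳ (inʳ (inʳ (inʳ (inʳ (nearlyBipartite (few f₀ f₁ f₂ f₃) (avoid no-C₅))))))))

  represented : Rep scheme G (λ _ → ⊥)
  represented =
    split (Contains G (complete 5)) (λ K₅ → inˡ (BigClique.bigClique em G no-diamond no-P₂+P₃ K₅)) λ no-K₅ →
    split (Contains G (complete 4)) (λ K₄ → inʳ (inˡ (rep-K₄ (avoid no-K₅) K₄))) λ no-K₄ →
    represented-K₄-free (avoid no-K₄)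

theorem2 : ∀ a ℓ → ExcludedMiddle (a ⊔ ℓ) →
    WQOByLabelledInducedSubgraph a ℓ (Free (complement (2 · P 1 ⊕ P 2) ∷ (P 2 ⊕ P 3) ∷ []))
theorem2 a ℓ em W _≤_ wqo (G , free , antichain) =
  let i , j , i<j , embeds = Represented.comparable em-ℓ wqo scheme G rep in antichain i j (<⇒≢ i<j) embeds
  where
  em-ℓ : ExcludedMiddle ℓ
  em-ℓ {Q} = map′ lower lift (em {Lift a Q})

  em-0 : ExcludedMiddle 0ℓ
  em-0 {Q} = map′ lower lift (em {Lift (a ⊔ ℓ) Q})

  rep : ∀ i → Rep scheme (graph (G i)) (λ _ → ⊥)
  rep i = let no-diamond , no-P₂+P₃ = free⇒avoids (graph (G i)) (free i) in
          represented em-0 (graph (G i)) no-diamond no-P₂+P₃
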